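{- Let $I$ be an ideal on a cardinal $\kappa$, and suppose there is a regular cardinal $\theta<\kappa$ such that $I$ is weakly $\theta$-saturated and $\theta$-indecomposable. Then: (1) $S^*(I)$ is stationary in $\kappa$; (2)–(3) there is a function $f^*:\kappa\to\kappa$ which is a least function modulo $I$ and such that for every stationary $S\subseteq S^*(I)$, the set $S\cap f^*(\alpha)$ is stationary in $f^*(\alpha)$ for $I$-almost all $\alpha<\kappa$; (4) $S^*(I)$ is a stationary subset of $\kappa$ for which $\mathrm{Refl}(<\mathrm{comp}(I), S^*(I))$ holds.
   Context: By an ideal on a cardinal $\kappa$ we mean a proper ideal on $\kappa$ containing all bounded subsets of $\kappa$. "$\varphi$ holds for $I$-almost all $\alpha<\kappa$" means $\{\alpha<\kappa:\varphi(\alpha)\text{ fails}\}\in I$; $g<_I f$ means $g(\alpha)<f(\alpha)$ for $I$-almost all $\alpha$. $I$ is weakly $\theta$-saturated if there is no partition of $\kappa$ into $\theta$ pairwise disjoint sets not in $I$. $I$ is $\tau$-indecomposable if whenever $\langle A_i:i<\tau\rangle$ are subsets of $\kappa$ with $\bigcup_{i<\tau}A_i\notin I$ there is $w\subseteq\tau$, $|w|<\tau$, with $\bigcup_{i\in w}A_i\notin I$. $\mathrm{comp}(I)$ is the least cardinal $\tau$ such that $I$ is closed under unions of fewer than $\tau$ sets; $\mathrm{wsat}(I)$ is the least cardinal $\theta$ such that $I$ is weakly $\theta$-saturated; $\mathrm{indec}(I)=\{\tau<\kappa: I\text{ is }\tau\text{ -indecomposable}\}$; $S^*(I)=\{\alpha<\kappa:\mathrm{wsat}(I)\leq\mathrm{cf}(\alpha)<\alpha\text{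 and }\mathrm{cf}(\alpha)\in\mathrm{indec}(I)\}$. A function $f:\kappa\to\kappa$ is bounded modulo $I$ if there is $\xi<\kappa$ with $\{\alpha<\kappa:\xi<f(\alpha)\}\in I$; $f$ is a least function modulo $I$ if $f$ is not bounded modulo $I$ but every $g$ with $g<_I f$ is bounded modulo $I$. For regular uncountable $\kappa$ and stationary $S\subseteq\kappa$: a stationary $T$ reflects at $\alpha<\kappa$ if $\mathrm{cf}(\alpha)>\aleph_0$ and $T\cap\alpha$ is stationary in $\alpha$; $\mathrm{Refl}(<\nu,S)$ means that for every $\sigma<\nu$ and every sequence $\langle T_i:i<\sigma\rangle$ of stationary subsets of $S$ there is $\alpha<\kappa$ at which every $T_i$ reflects.
   Formalization: κ is assumed regular: Refl is defined only for regular uncountable κ, and (1) fails e.g. for κ=ℵ_ω; comp(I) is read as the least τ such that some union of τ sets in I is not in I, and wsat(I) as the least nonzero such θ. -}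

module Defs where

open import Axiom.ExcludedMiddle using (ExcludedMiddle)
open import Data.Bool using (Bool; true; T; _∧_; _∨_)
open import Data.Nat using (ℕ)
open import Data.Product using (Σ; ∃; _×_; _,_)
open import Function.Bundles using (_↣_)
open import Induction.WellFounded using (WellFounded)
open import Level using (Level) renaming (suc to lsuc)
open import Relation.Binary.Core using (Rel)
open import Relation.Binary.PropositionalEquality using (_≡_; _≢_)
open import Relation.Binary.Structures using (IsStrictTotalOrder)
open import Relation.Nullary using (¬_; yes; no; does)
open import Relation.Nullary.Construct.Add.Supremum using (_⁺; ⊤⁺; [_])
import Relation.Binary.Construct.Add.Supremum.Strict as AddSup
import Relation.Binary.Construct.StrictToNonStrict as ToNonStrict

record WellOrder (ℓ : Level) : Set (lsuc ℓ) where
  field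
    Carrier            : Set ℓ
    _≺_                : Rel Carrier ℓ
    isStrictTotalOrder : IsStrictTotalOrder _≡_ _≺_
    wellFounded        : WellFounded _≺_

-- The ambient theory is classical.  Since `ExcludedMiddle ℓ` decides arbitrary
-- types, not only propositions, it also yields the axiom of choice for
-- types in Set ℓ: it selects an element of every type that is not empty.

module Combinatorics {ℓ : Level} (em : ExcludedMiddle ℓ) (W : WellOrder ℓ) where

  open WellOrder W renaming (Carrier to K)

  -- Subsets of κ, coded by characteristic functions.  By excluded middle
  -- every predicate K → Set ℓ is represented, and the collection of all
  -- subsets is again a type in Set ℓ.

  Subset : Set ℓ
  Subset = K → Bool

  infix 4 _∈_ _⊆_

  _∈_ : K → Subset → Set
  x ∈ A = T (A x)

  _⊆_ : Subset → Subset → Set ℓ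
  A ⊆ B = ∀ x → x ∈ A → x ∈ B

  comprehension : (K → Set ℓ) → Subset
  comprehension P x = does (em {P x})

  syntax comprehension (λ x → P) = ｛ x ∣ P ｝

  full : Subset
  full _ = true

  _∩_ _∪_ : Subset → Subset → Subset
  (A ∩ B) x = A x ∧ B x
  (A ∪ B) x = A x ∨ B x

  -- A sequence ⟨ A i : i < τ ⟩ is given by a total function on K, of which only
  -- the values at i < τ are ever used.
  ⋃ : Subset → (K → Subset) → Subset
  ⋃ w A = ｛ x ∣ (∃ λ i → i ∈ w × x ∈ A i) ｝

  -- The ordinals ≤ κ: an element ξ of K is the ordinal [ ξ ] < κ (the order
  -- type of its set of predecessors), and the added supremum is κ itself.

  Ord : Set ℓ
  Ord = K ⁺

  κ : Ord
  κ = ⊤⁺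

  open AddSup _≺_ public using () renaming (_<⁺_ to _<_)
  open ToNonStrict (_≡_ {A = Ord}) _<_ public using (_≤_)

  ↓ : Ord → Subset
  ↓ ν = ｛ ξ ∣ [ ξ ] < ν ｝

  -- The least ordinal satisfying P.  The value κ in the second case is
  -- only taken when no ordinal ≤ κ satisfies P.
  least : (Ord → Set ℓ) → Ord
  least P with em {∃ λ ν → P ν × (∀ μ → P μ → ν ≤ μ)}
  ... | yes (ν , _) = ν
  ... | no  _       = κ

  Elt : Subset → Set ℓ
  Elt A = Σ K (_∈ A)

  infix 4 _<ᶜ_

  _<ᶜ_ : Subset → Subset → Set ℓ
  A <ᶜ B = (Elt A ↣ Elt B) × ¬ (Elt B ↣ Elt A)

  IsCardinal : Ord → Set ℓ
  IsCardinal ν = ∀ α → [ α ] < ν → ↓ [ α ] <ᶜ ↓ ν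

  Infinite : Ord → Set ℓ
  Infinite ν = ℕ ↣ Elt (↓ ν)

  ℵ₀ : Ord
  ℵ₀ = least Infinite

  CofinalMap : Ord → Ord → Set ℓ
  CofinalMap μ ν = ∃ λ (f : K → K) →
    (∀ i → [ i ] < μ → [ f i ] < ν) ×
    (∀ ξ → [ ξ ] < ν → ∃ λ i → [ i ] < μ × [ ξ ] ≤ [ f i ])

  cf : Ord → Ord
  cf ν = least (λ μ → CofinalMap μ ν)

  Regular : Ord → Set ℓ
  Regular ν = IsCardinal ν × Infinite ν × cf ν ≡ ν

  Unbounded : Subset → Ord → Set ℓ
  Unbounded C ν = ∀ ξ → [ ξ ] < ν → ∃ λ η → η ∈ C × [ ξ ] ≤ [ η ] × [ η ] < ν

  -- The strict inequality ξ ≺ η forces δ to be a limit ordinal.  (In Unbounded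
  -- it is weak, so that { β } is unbounded in β + 1.)
  LimitPoint : Subset → K → Set ℓ
  LimitPoint C δ =
    (∃ λ ξ → ξ ≺ δ) ×
    (∀ ξ → ξ ≺ δ → ∃ λ η → η ∈ C × ξ ≺ η × η ≺ δ)

  Club : Subset → Ord → Set ℓ
  Club C ν =
    C ⊆ ↓ ν ×
    Unbounded C ν ×
    (∀ δ → [ δ ] < ν → LimitPoint C δ → δ ∈ C)

  Stationary : Subset → Ord → Set ℓ
  Stationary A ν =
    A ⊆ ↓ ν × (∀ C → Club C ν → ∃ λ δ → δ ∈ A × δ ∈ C)

  ReflectsAt : Subset → K → Set ℓ
  ReflectsAt A α = ℵ₀ < cf [ α ] × Stationary (A ∩ ↓ [ α ]) [ α ]

  Refl< : Ord → Subset → Set ℓ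
  Refl< ν S = ∀ σ → σ < ν → (A : K → Subset) →
    (∀ i → [ i ] < σ → Stationary (A i) κ × A i ⊆ S) →
    ∃ λ α → ∀ i → [ i ] < σ → ReflectsAt (A i) α

  record IsIdeal (I : Subset → Set ℓ) : Set ℓ where
    field
      downward : ∀ {A B} → A ⊆ B → I B → I A
      union    : ∀ {A B} → I A → I B → I (A ∪ B)
      proper   : ¬ I full
      bounded  : ∀ {A} → (∃ λ ξ → A ⊆ ↓ [ ξ ]) → I A

  module _ (I : Subset → Set ℓ) where

    AlmostAll : (K → Set ℓ) → Set ℓ
    AlmostAll φ = I ｛ α ∣ ¬ φ α ｝

    _<ᴵ_ : (K → K) → (K → K) → Set ℓ
    g <ᴵ f = AlmostAll (λ α → g α ≺ f α)

    BoundedMod : (K → K) → Set ℓ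
    BoundedMod f = ∃ λ ξ → I ｛ α ∣ ξ ≺ f α ｝

    IsLeastFunction : (K → K) → Set ℓ
    IsLeastFunction f = ¬ BoundedMod f × (∀ g → g <ᴵ f → BoundedMod g)

    WeaklySaturated : Ord → Set ℓ
    WeaklySaturated θ = ¬ (∃ λ (A : K → Subset) →
      (∀ i → [ i ] < θ → ¬ I (A i)) ×
      (∀ i j → [ i ] < θ → [ j ] < θ → i ≢ j → ∀ α → α ∈ A i → ¬ α ∈ A j) ×
      (∀ α → ∃ λ i → [ i ] < θ × α ∈ A i))

    Indecomposable : Ord → Set ℓ
    Indecomposable τ = (A : K → Subset) → ¬ I (⋃ (↓ τ) A) →
      ∃ λ w → w ⊆ ↓ τ × w <ᶜ ↓ τ × ¬ I (⋃ w A)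

    ClosedUnderUnions : Ord → Set ℓ
    ClosedUnderUnions τ = (A : K → Subset) →
      (∀ i → [ i ] < τ → I (A i)) → I (⋃ (↓ τ) A)

    -- The completeness: I is closed under unions of fewer than comp sets, and
    -- comp is maximal with this property, i.e. it is the least τ for which
    -- some union of τ sets in I is not in I.
    comp : Ord
    comp = least (λ τ → IsCardinal τ × ¬ ClosedUnderUnions τ)

    -- θ ranges over nonzero cardinals: a nonempty κ has no partition into
    -- zero sets, so θ = 0 would qualify for a trivial reason.
    wsat : Ord
    wsat = least (λ θ → IsCardinal θ × Elt (↓ θ) × WeaklySaturated θ)

    indec : Ord → Set ℓ
    indec τ = τ < κ × Indecomposable τ

    S* : Subset
    S* = ｛ α ∣ wsat ≤ cf [ α ] × cf [ α ] < [ α ] × indec (cf [ α ]) ｝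

{-# OPTIONS --safe #-}
module Submission where

open import Axiom.ExcludedMiddle using (ExcludedMiddle)
open import Axiom.Extensionality.Propositional using (Extensionality)
open import Data.Bool.Properties using (T-irrelevant; T-∧; T-∨)
open import Data.Empty using (⊥; ⊥-elim)
open import Data.Nat using (ℕ; zero; suc)
import Data.Nat as ℕ
import Data.Nat.Properties as ℕ
open import Data.Product using (∃; _×_; _,_; proj₁; proj₂)
import Data.Sum as Sum
open import Data.Sum using (_⊎_; inj₁; inj₂)
open import Data.Unit using (tt)
open import Function.Base using (_∘_; id)
open import Function.Bundles using (_↣_; mk↣; Injection; Equivalence)
import Function.Construct.Composition as Compose
import Function.Construct.Identity as Identity
open import Induction.WellFounded using (module All; module FixPoint)
open import Level using (Level)
open import Relation.Binary.Definitions using (tri<; tri≈; tri>)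
open import Relation.Binary.PropositionalEquality
  using (_≡_; _≢_; refl; sym; trans; cong; subst)
open import Relation.Binary.Structures using (IsStrictTotalOrder)
open import Relation.Nullary using (¬_; yes; no)
open import Relation.Nullary.Construct.Add.Supremum using (⊤⁺; [_])
import Relation.Binary.Construct.Add.Supremum.Strict as AddSup
open import Defs

-- Saturation and indecomposability at a regular τ together make every function
-- κ → τ bounded modulo I, for otherwise τ pairwise disjoint intervals would have
-- positive preimages.
--
-- Least function.  Call f big if f > ξ almost everywhere for every ξ < κ; the
-- identity is big.  If no big function were least, a recursion of length θ would
-- give big f i, each below on a positive set the function sending α to the least
-- element above ξ i of { α } ∪ { f j α : j < i }; some ξ i keeps that function big.
-- With ξ* above all ξ i, the minimum of { f j α : j < θ } above ξ* is attained
-- at a stage bounded modulo I by some i₀ < θ, so f (i₀ + 1) is not below on a positive set.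
--
-- Reflection.  If clubs C α ⊆ f* α avoid S on a positive set of α, leastness bounds
-- the next point of C α after ξ modulo I, so some δ ∈ S is closed under these bounds.
-- Boundedness of functions into cf δ makes δ a limit point of C α for some such α.

-- Classical logic and choice.

module _ {ℓ : Level} (em : ExcludedMiddle ℓ) where

  opaque

    dne : {P : Set ℓ} → ¬ ¬ P → P
    dne {P} ¬¬p with em {P}
    ... | yes p = p
    ... | no ¬p = ⊥-elim (¬¬p ¬p)

    ¬∀⇒∃¬ : {X : Set ℓ} {P : X → Set ℓ} → ¬ (∀ x → P x) → ∃ λ x → ¬ P x
    ¬∀⇒∃¬ h = dne λ ¬e → h λ x → dne λ ¬p → ¬e (x , ¬p)

    -- The witness from `h` may depend on the proof of `P x`; `em` fixes one proof, and `d` gives a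
    -- value where `P` fails.
    skolem : {X Y : Set ℓ} {P : X → Set ℓ} {Q : X → Y → Set ℓ} → (X → Y) →
      (∀ x → P x → ∃ (Q x)) → ∃ λ (f : X → Y) → ∀ x → P x → Q x (f x)
    skolem {X} {Y} {P} {Q} d h = (λ x → proj₁ (pick x)) , λ x → proj₂ (pick x)
      where
      pick : ∀ x → ∃ λ y → P x → Q x y
      pick x with em {P x}
      ... | yes p = let (y , q) = h x p in y , λ _ → q
      ... | no ¬p = d x , λ p → ⊥-elim (¬p p)

-- The order on ordinals, and least elements.

module Ordinals {ℓ : Level} (em : ExcludedMiddle ℓ) (ext : Extensionality ℓ ℓ)
  (W : WellOrder ℓ) where

  open WellOrder W renaming (Carrier to K)
  open Combinatorics em W
  open AddSup _≺_ using ([_]<⊤⁺; [<]-injective; <⁺-isStrictTotalOrder-≡) renaming ([_] to ↑)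
  module ≺ = IsStrictTotalOrder isStrictTotalOrder
  module < = IsStrictTotalOrder (<⁺-isStrictTotalOrder-≡ isStrictTotalOrder)

  ≺-irrefl : ∀ {x} → ¬ x ≺ x
  ≺-irrefl = ≺.irrefl refl

  infix 4 _≼_

  _≼_ : K → K → Set ℓ
  x ≼ y = ¬ y ≺ x

  opaque

    ≺⇒≼ : ∀ {x y} → x ≺ y → x ≼ y
    ≺⇒≼ = ≺.asym

    ≼-total : ∀ x y → x ≼ y ⊎ y ≺ x
    ≼-total x y with ≺.compare x y
    ... | tri< _ _ y≮x = inj₁ y≮x
    ... | tri≈ _ _ y≮x = inj₁ y≮x
    ... | tri> _ _ y≺x = inj₂ y≺x

    ≼-≺-trans : ∀ {x y z} → x ≼ y → y ≺ z → x ≺ z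
    ≼-≺-trans {x} {y} x≼y y≺z with ≺.compare x y
    ... | tri< x≺y _ _ = ≺.trans x≺y y≺z
    ... | tri≈ _ refl _ = y≺z
    ... | tri> _ _ y≺x = ⊥-elim (x≼y y≺x)

    ≺-≼-trans : ∀ {x y z} → x ≺ y → y ≼ z → x ≺ z
    ≺-≼-trans {x} {y} {z} x≺y y≼z with ≺.compare y z
    ... | tri< y≺z _ _ = ≺.trans x≺y y≺z
    ... | tri≈ _ refl _ = x≺y
    ... | tri> _ _ z≺y = ⊥-elim (y≼z z≺y)

    ≼-trans : ∀ {x y z} → x ≼ y → y ≼ z → x ≼ z
    ≼-trans x≼y y≼z z≺x = y≼z (≺-≼-trans z≺x x≼y)

    ≼⇒≤ : ∀ {x y} → x ≼ y → [ x ] ≤ [ y ]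
    ≼⇒≤ {x} {y} x≼y with ≺.compare x y
    ... | tri< x≺y _ _ = inj₁ (↑ x≺y)
    ... | tri≈ _ refl _ = inj₂ refl
    ... | tri> _ _ y≺x = ⊥-elim (x≼y y≺x)

    ≤⇒≼ : ∀ {x y} → [ x ] ≤ [ y ] → x ≼ y
    ≤⇒≼ (inj₁ p) = ≺⇒≼ ([<]-injective p)
    ≤⇒≼ (inj₂ refl) = ≺-irrefl

    <-≤-trans : ∀ {μ ν ρ} → μ < ν → ν ≤ ρ → μ < ρ
    <-≤-trans p (inj₁ q) = <.trans p q
    <-≤-trans p (inj₂ refl) = p

    ≤-<-trans : ∀ {μ ν ρ} → μ ≤ ν → ν < ρ → μ < ρ
    ≤-<-trans (inj₁ p) q = <.trans p q
    ≤-<-trans (inj₂ refl) q = q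

    ≤-trans : ∀ {μ ν ρ} → μ ≤ ν → ν ≤ ρ → μ ≤ ρ
    ≤-trans (inj₁ p) q = inj₁ (<-≤-trans p q)
    ≤-trans (inj₂ refl) q = q

    ≤⇒≯ : ∀ {μ ν} → μ ≤ ν → ¬ ν < μ
    ≤⇒≯ p q = <.irrefl refl (<-≤-trans q p)

    ≮⇒≥ : ∀ {μ ν} → ¬ μ < ν → ν ≤ μ
    ≮⇒≥ {μ} {ν} p with <.compare μ ν
    ... | tri< μ<ν _ _ = ⊥-elim (p μ<ν)
    ... | tri≈ _ refl _ = inj₂ refl
    ... | tri> _ _ ν<μ = inj₁ ν<μ

    ∈⁺ : ∀ (P : K → Set ℓ) {x} → P x → x ∈ comprehension P
    ∈⁺ P {x} p with em {P x}
    ... | yes _ = tt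
    ... | no ¬p = ⊥-elim (¬p p)

    ∈⁻ : ∀ (P : K → Set ℓ) {x} → x ∈ comprehension P → P x
    ∈⁻ P {x} _ with em {P x}
    ... | yes p = p

    ↓⁺ : ∀ {ν x} → [ x ] < ν → x ∈ ↓ ν
    ↓⁺ {ν} = ∈⁺ (λ ξ → [ ξ ] < ν)

    ↓⁻ : ∀ {ν x} → x ∈ ↓ ν → [ x ] < ν
    ↓⁻ {ν} = ∈⁻ (λ ξ → [ ξ ] < ν)

    minimum : (P : K → Set ℓ) → ∃ P → ∃ λ x → P x × (∀ y → P y → x ≼ y)
    minimum P (x , p) = All.wfRec wellFounded ℓ Minimum step x p
      where
      Minimum : K → Set ℓ
      Minimum x = P x → ∃ λ x → P x × (∀ y → P y → x ≼ y)
      step : ∀ x → (∀ {y} → y ≺ x → Minimum y) → Minimum x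
      step x rec p with em {∃ λ y → P y × y ≺ x}
      ... | yes (y , q , y≺x) = rec y≺x q
      ... | no ¬e = x , p , λ y q y≺x → ¬e (y , q , y≺x)

    least-spec : (P : Ord → Set ℓ) → ∃ P → P (least P) × (∀ μ → P μ → least P ≤ μ)
    least-spec P e with em {∃ λ ν → P ν × (∀ μ → P μ → ν ≤ μ)}
    ... | yes (_ , h) = h
    ... | no ¬h = ⊥-elim (¬h (attained e))
      where
      attained : ∃ P → ∃ λ ν → P ν × (∀ μ → P μ → ν ≤ μ)
      attained (ν , p) with em {∃ λ x → P [ x ]}
      ... | yes e′ = let (x , q , min) = minimum (P ∘ [_]) e′ in
        [ x ] , q , λ { ⊤⁺ _ → inj₁ [ x ]<⊤⁺ ; [ y ] r → ≼⇒≤ (min y r) }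
      attained (⊤⁺ , p) | no ¬e = ⊤⁺ , p , λ { ⊤⁺ _ → inj₂ refl ; [ y ] r → ⊥-elim (¬e (y , r)) }
      attained ([ x ] , p) | no ¬e = ⊥-elim (¬e (x , p))

    Elt-≡ : ∀ {A} {u v : Elt A} → proj₁ u ≡ proj₁ v → u ≡ v
    Elt-≡ {u = x , p} {v = .x , q} refl = cong (x ,_) (T-irrelevant p q)

  -- Transfinite recursion.

  module _ {X : Set ℓ} (Q : K → (K → X) → X → Set ℓ) (d : K → X)
    (step : ∀ t r → ∃ (Q t r)) where

    private
      truncate : ∀ t → (∀ {s} → s ≺ t → X) → K → X
      truncate t r s with em {s ≺ t}
      ... | yes p = r p
      ... | no  _ = d s

      next : ∀ t → (∀ {s} → s ≺ t → X) → X
      next t r = proj₁ (step t (truncate t r))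

      -- `step` receives the history as a function, so extensionality is what gives pointwise equal
      -- histories the same choice.
      next-cong : ∀ t {r r′ : ∀ {s} → s ≺ t → X} →
        (∀ {s} (p : s ≺ t) → r p ≡ r′ p) → next t r ≡ next t r′
      next-cong t {r} {r′} eq = cong (λ h → proj₁ (step t h)) (ext pointwise)
        where
        pointwise : ∀ s → truncate t r s ≡ truncate t r′ s
        pointwise s with em {s ≺ t}
        ... | yes p = eq p
        ... | no  _ = refl

      open FixPoint wellFounded (λ _ → X) next next-cong using (unfold-wfRec)

    -- r is x below t, with junk values from t on.
    opaque
      transfinite : ∃ λ (x : K → X) → ∀ t → ∃ λ r → (∀ s → s ≺ t → r s ≡ x s) × Q t r (x t)
      transfinite = x , λ t → truncate t (λ {s} _ → x s) , agrees t ,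
        subst (Q t _) (sym unfold-wfRec) (proj₂ (step t _))
        where
        x : K → X
        x = All.wfRec wellFounded ℓ (λ _ → X) next
        agrees : ∀ t s → s ≺ t → truncate t (λ {s} _ → x s) s ≡ x s
        agrees t s s≺t with em {s ≺ t}
        ... | yes _ = refl
        ... | no ¬p = ⊥-elim (¬p s≺t)

  -- For regular ν this is τ ≤ ν; it is what is used of τ ≤ cf ν.
  Bounds : Ord → Ord → Set ℓ
  Bounds τ ν = ∀ t → [ t ] < τ → (x : K → K) → (∀ s → s ≺ t → [ x s ] < ν) →
    ∃ λ y → [ y ] < ν × (∀ s → s ≺ t → x s ≺ y)

  -- Cofinality and increasing sequences.

  cf-cofinal : ∀ ν → CofinalMap (cf ν) ν
  cf-cofinal ν = proj₁ (least-spec (λ μ → CofinalMap μ ν) (ν , id , (λ _ p → p) , λ ξ p → ξ , p , inj₂ refl))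

  cf-≤ : ∀ {μ ν} → CofinalMap μ ν → cf ν ≤ μ
  cf-≤ {μ} {ν} c = proj₂ (least-spec (λ μ → CofinalMap μ ν) (μ , c)) μ c

  opaque

    ¬bounded⇒cofinal : ∀ {ν t} {x : K → K} → ¬ (∃ λ y → [ y ] < ν × (∀ s → s ≺ t → x s ≺ y)) →
      ∀ y → [ y ] < ν → ∃ λ s → s ≺ t × y ≼ x s
    ¬bounded⇒cofinal {ν} {t} {x} ¬bounded y y<ν =
      dne em λ ¬e → ¬bounded (y , y<ν , λ s s≺t → dne em λ y≼xs → ¬e (s , s≺t , y≼xs))

    -- An unbounded sequence of length `t < cf ν` would be a cofinal map from `t`.
    cf-bounds : ∀ ν → Bounds (cf ν) ν
    cf-bounds ν t t<cf x x<ν = dne em λ ¬bounded →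
      let cofinal ξ ξ<ν = let (s , s≺t , ξ≼xs) = ¬bounded⇒cofinal ¬bounded ξ ξ<ν in
            s , ↑ s≺t , ≼⇒≤ ξ≼xs
      in ≤⇒≯ (cf-≤ (x , (λ s p → x<ν s ([<]-injective p)) , cofinal)) t<cf

    upper : ∀ {ν} x y → [ x ] < ν → [ y ] < ν → ∃ λ z → [ z ] < ν × x ≼ z × y ≼ z
    upper x y x<ν y<ν with ≼-total x y
    ... | inj₁ x≼y = y , y<ν , x≼y , ≺-irrefl
    ... | inj₂ y≺x = x , x<ν , ≺-irrefl , ≺⇒≼ y≺x

    -- This replaces monotonicity of `g`.
    dominating : ∀ {τ ν} → Bounds τ ν → (g : K → K) → (∀ i → [ i ] < τ → [ g i ] < ν) →
      ∀ β → [ β ] < τ → ∃ λ z → [ z ] < ν × (∀ i → i ≼ β → g i ≼ z)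
    dominating bounds g g<ν β β<τ =
      let (y , y<ν , g<y) = bounds β β<τ g (λ i i≺β → g<ν i (<.trans (↑ i≺β) β<τ))
          (z , z<ν , y≼z , gβ≼z) = upper y (g β) y<ν (g<ν β β<τ)
      in z , z<ν , λ i i≼β → cases i i≼β (λ i≺β → ≼-trans (≺⇒≼ (g<y i i≺β)) y≼z) gβ≼z
      where
      cases : ∀ {z} i → i ≼ β → (i ≺ β → g i ≼ z) → g β ≼ z → g i ≼ z
      cases i i≼β f e with ≺.compare i β
      ... | tri< i≺β _ _ = f i≺β
      ... | tri≈ _ refl _ = e
      ... | tri> _ _ β≺i = ⊥-elim (i≼β β≺i)

    -- This is the regularity of a cofinality. The bounds `G (x s)` lie below some `y`, and
    -- `y ≤ g i` for some `i`; a term `x s` at or above `i` would give `g i ≼ G (x s) ≺ y`.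
    cofinal⇒regular : ∀ {τ ν} → CofinalMap τ ν → Bounds τ ν → Bounds τ τ
    cofinal⇒regular (g , g<ν , g-cofinal) bounds t t<τ x x<τ =
      let (G , G-spec) = skolem em id (dominating bounds g g<ν)
          (y , y<ν , G<y) = bounds t t<τ (G ∘ x) (λ s s≺t → proj₁ (G-spec (x s) (x<τ s s≺t)))
          (i , i<τ , y≤gi) = g-cofinal y y<ν
      in dne em λ ¬bounded →
        let (s , s≺t , i≼xs) = ¬bounded⇒cofinal ¬bounded i i<τ
        in ≤⇒≼ y≤gi (≼-≺-trans (proj₂ (G-spec (x s) (x<τ s s≺t)) i i≼xs) (G<y s s≺t))

    -- The role of `ζ` is to make the intervals from `x t` to `ζ (x t)` disjoint; a cofinal `g`
    -- makes the sequence cofinal.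
    chain : ∀ {τ ν} → Bounds τ ν → (ζ g : K → K) →
      (∀ x → [ x ] < ν → [ ζ x ] < ν) → (∀ t → [ t ] < τ → [ g t ] < ν) →
      ∃ λ (x : K → K) → (∀ t → [ t ] < τ → [ x t ] < ν) ×
        (∀ s t → s ≺ t → [ t ] < τ → ζ (x s) ≺ x t) × (∀ t → [ t ] < τ → g t ≼ x t)
    chain {τ} {ν} bounds ζ g ζ<ν g<ν = x , x<ν , increasing , above
      where
      Admissible : K → (K → K) → Set ℓ
      Admissible t r = [ t ] < τ × (∀ s → s ≺ t → [ r s ] < ν)
      Next : K → (K → K) → K → Set ℓ
      Next t r y = [ y ] < ν × (∀ s → s ≺ t → ζ (r s) ≺ y) × g t ≼ y
      step : ∀ t r → ∃ λ y → Admissible t r → Next t r y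
      step t r with em {Admissible t r}
      -- The recursion runs over all of `K`; the value at an inadmissible history is arbitrary.
      ... | no ¬a = t , λ a → ⊥-elim (¬a a)
      ... | yes (t<τ , r<ν) =
        let (y , y<ν , ζr<y) = bounds t t<τ (ζ ∘ r) (λ s s≺t → ζ<ν (r s) (r<ν s s≺t))
            (z , z<ν , y≼z , g≼z) = upper y (g t) y<ν (g<ν t t<τ)
        in z , λ _ → z<ν , (λ s s≺t → ≺-≼-trans (ζr<y s s≺t) y≼z) , g≼z
      sequence : ∃ λ (x : K → K) → ∀ t → ∃ λ r →
        (∀ s → s ≺ t → r s ≡ x s) × (Admissible t r → Next t r (x t))
      sequence = transfinite (λ t r y → Admissible t r → Next t r y) id step
      x : K → K
      x = proj₁ sequence
      spec : ∀ t → [ t ] < τ → (∀ s → s ≺ t → [ x s ] < ν) → Next t x (x t)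
      spec t t<τ x<ν =
        let (r , r≡x , next) = proj₂ sequence t
            (xt<ν , ζr<xt , g≼xt) =
              next (t<τ , λ s s≺t → subst (λ y → [ y ] < ν) (sym (r≡x s s≺t)) (x<ν s s≺t))
        in xt<ν , (λ s s≺t → subst (λ y → ζ y ≺ x t) (r≡x s s≺t) (ζr<xt s s≺t)) , g≼xt
      x<ν : ∀ t → [ t ] < τ → [ x t ] < ν
      x<ν = All.wfRec wellFounded ℓ (λ t → [ t ] < τ → [ x t ] < ν) λ t rec t<τ →
        proj₁ (spec t t<τ λ s s≺t → rec s≺t (<.trans (↑ s≺t) t<τ))
      spec′ : ∀ t → [ t ] < τ → Next t x (x t)
      spec′ t t<τ = spec t t<τ λ s s≺t → x<ν s (<.trans (↑ s≺t) t<τ)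
      increasing : ∀ s t → s ≺ t → [ t ] < τ → ζ (x s) ≺ x t
      increasing s t s≺t t<τ = proj₁ (proj₂ (spec′ t t<τ)) s s≺t
      above : ∀ t → [ t ] < τ → g t ≼ x t
      above t t<τ = proj₂ (proj₂ (spec′ t t<τ))

    -- `Bounds` is applied to the constant sequence `x`, whose length `t` must be positive; hence
    -- two elements `s ≺ t` are taken from `inf`.
    Infinite-limit : ∀ {ν} → Infinite ν → Bounds ν ν → ∀ x → [ x ] < ν → ∃ λ y → [ y ] < ν × x ≺ y
    Infinite-limit {ν} inf bounds x x<ν =
      let (s , t , s≺t , t<ν) = two
          (y , y<ν , x≺y) = bounds t t<ν (λ _ → x) (λ _ _ → x<ν)
      in y , y<ν , x≺y s s≺t
      where
      open Injection inf
      two : ∃ λ s → ∃ λ t → s ≺ t × [ t ] < ν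
      two with ≺.compare (proj₁ (to 0)) (proj₁ (to 1))
      ... | tri< a≺b _ _ = _ , _ , a≺b , ↓⁻ {ν} (proj₂ (to 1))
      ... | tri> _ _ b≺a = _ , _ , b≺a , ↓⁻ {ν} (proj₂ (to 0))
      ... | tri≈ _ a≡b _ with injective (Elt-≡ {A = ↓ ν} a≡b)
      ... | ()

    limit-Infinite : ∀ t → (∃ λ s → s ≺ t) → (∀ s → s ≺ t → ∃ λ s′ → s′ ≺ t × s ≺ s′) → Infinite [ t ]
    limit-Infinite t (s₀ , s₀≺t) next =
      mk↣ {to = λ n → proj₁ (e n) , ↓⁺ {[ t ]} (↑ (proj₂ (e n)))} (injective ∘ cong proj₁)
      where
      e : ℕ → ∃ λ s → s ≺ t
      e zero = s₀ , s₀≺t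
      e (suc n) = let (s , s≺t , _) = next (proj₁ (e n)) (proj₂ (e n)) in s , s≺t
      e-suc : ∀ n → proj₁ (e n) ≺ proj₁ (e (suc n))
      e-suc n = proj₂ (proj₂ (next (proj₁ (e n)) (proj₂ (e n))))
      e-mono : ∀ {m n} → m ℕ.<′ n → proj₁ (e m) ≺ proj₁ (e n)
      e-mono {m} ℕ.<′-base = e-suc m
      e-mono {m} {suc n} (ℕ.≤′-step m<n) = ≺.trans (e-mono {m} m<n) (e-suc n)
      injective : ∀ {m n} → proj₁ (e m) ≡ proj₁ (e n) → m ≡ n
      injective {m} {n} eq with ℕ.<-cmp m n
      ... | tri< m<n _ _ = ⊥-elim (≺.irrefl eq (e-mono {m} {n} (ℕ.<⇒<′ m<n)))
      ... | tri≈ _ m≡n _ = m≡n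
      ... | tri> _ _ n<m = ⊥-elim (≺.irrefl (sym eq) (e-mono {n} {m} (ℕ.<⇒<′ n<m)))

    -- This converts the cardinality bound in indecomposability into an upper bound: an unbounded
    -- `w` would contain the increasing values `ζ (x t)`, hence a copy of `τ`.
    small⇒bounded : ∀ {τ w} → Bounds τ τ → w ⊆ ↓ τ → w <ᶜ ↓ τ →
      ∃ λ y → [ y ] < τ × (∀ i → i ∈ w → i ≼ y)
    small⇒bounded {τ} {w} bounds w⊆τ (_ , ¬inj) = dne em λ ¬bounded → ¬inj (injection ¬bounded)
      where
      injection : ¬ (∃ λ y → [ y ] < τ × (∀ i → i ∈ w → i ≼ y)) → Elt (↓ τ) ↣ Elt w
      injection ¬bounded = mk↣
        {to = λ (t , t∈τ) → ζ (x t) , proj₁ (ζx t (↓⁻ {τ} t∈τ))} λ {u} {v} eq → injective {u} {v} (cong proj₁ eq)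
        where
        unbounded : ∀ y → [ y ] < τ → ∃ λ i → i ∈ w × y ≺ i
        unbounded y y<τ = dne em λ ¬e → ¬bounded (y , y<τ , λ i i∈w y≺i → ¬e (i , i∈w , y≺i))
        ζ-choice : ∃ λ (ζ : K → K) → ∀ y → [ y ] < τ → ζ y ∈ w × y ≺ ζ y
        ζ-choice = skolem em id unbounded
        ζ : K → K
        ζ = proj₁ ζ-choice
        chain-ζ : ∃ λ (x : K → K) → (∀ t → [ t ] < τ → [ x t ] < τ) ×
          (∀ s t → s ≺ t → [ t ] < τ → ζ (x s) ≺ x t) × (∀ t → [ t ] < τ → t ≼ x t)
        chain-ζ = chain bounds ζ id
          (λ y y<τ → ↓⁻ {τ} (w⊆τ (ζ y) (proj₁ (proj₂ ζ-choice y y<τ)))) (λ _ p → p)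
        x : K → K
        x = proj₁ chain-ζ
        ζx : ∀ t → [ t ] < τ → ζ (x t) ∈ w × x t ≺ ζ (x t)
        ζx t t<τ = proj₂ ζ-choice (x t) (proj₁ (proj₂ chain-ζ) t t<τ)
        increasing : ∀ s t → s ≺ t → [ t ] < τ → ζ (x s) ≺ ζ (x t)
        increasing s t s≺t t<τ =
          ≺.trans (proj₁ (proj₂ (proj₂ chain-ζ)) s t s≺t t<τ) (proj₂ (ζx t t<τ))
        injective : ∀ {u v : Elt (↓ τ)} → ζ (x (proj₁ u)) ≡ ζ (x (proj₁ v)) → u ≡ v
        injective {s , s∈τ} {t , t∈τ} eq with ≺.compare s t
        ... | tri< s≺t _ _ = ⊥-elim (≺.irrefl eq (increasing s t s≺t (↓⁻ {τ} t∈τ)))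
        ... | tri≈ _ s≡t _ = Elt-≡ {A = ↓ τ} s≡t
        ... | tri> _ _ t≺s = ⊥-elim (≺.irrefl (sym eq) (increasing t s t≺s (↓⁻ {τ} s∈τ)))

    intervals-unique : ∀ {τ} {x y : K → K} → (∀ s t → s ≺ t → [ t ] < τ → y s ≺ x t) →
      ∀ {s t v} → [ s ] < τ → [ t ] < τ → x s ≺ v → v ≼ y s → x t ≺ v → v ≼ y t → s ≡ t
    intervals-unique gap {s} {t} s<τ t<τ xs≺v v≼ys xt≺v v≼yt with ≺.compare s t
    ... | tri< s≺t _ _ = ⊥-elim (≺-irrefl (≺-≼-trans (≺.trans (gap s t s≺t t<τ) xt≺v) v≼ys))
    ... | tri≈ _ s≡t _ = s≡t
    ... | tri> _ _ t≺s = ⊥-elim (≺-irrefl (≺-≼-trans (≺.trans (gap t s t≺s s<τ) xs≺v) v≼yt))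

-- Null and positive sets, weak saturation.

module Ideals {ℓ : Level} (em : ExcludedMiddle ℓ) (ext : Extensionality ℓ ℓ)
  (W : WellOrder ℓ) (I : Combinatorics.Subset em W → Set ℓ)
  (isIdeal : Combinatorics.IsIdeal em W I) where

  open WellOrder W renaming (Carrier to K)
  open Combinatorics em W
  open Ordinals em ext W
  open IsIdeal isIdeal

  Null : (K → Set ℓ) → Set ℓ
  Null P = I (comprehension P)

  opaque

    null-mono : ∀ {P Q} → (∀ x → P x → Q x) → Null Q → Null P
    null-mono {P} {Q} P⊆Q = downward λ x p → ∈⁺ Q (P⊆Q x (∈⁻ P p))

    null-⊎ : ∀ {P Q} → Null P → Null Q → Null (λ x → P x ⊎ Q x)
    null-⊎ {P} {Q} p q = downward
      (λ x m → Equivalence.from T-∨ (Sum.map (∈⁺ P) (∈⁺ Q) (∈⁻ (λ x → P x ⊎ Q x) m))) (union p q)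

  Almost : (K → Set ℓ) → Set ℓ
  Almost = AlmostAll I

  opaque

    almost-map : ∀ {P Q} → (∀ x → P x → Q x) → Almost P → Almost Q
    almost-map P⊆Q = null-mono λ x ¬q p → ¬q (P⊆Q x p)

    almost-× : ∀ {P Q} → Almost P → Almost Q → Almost (λ x → P x × Q x)
    almost-× {P} {Q} p q = null-mono cases (null-⊎ p q)
      where
      cases : ∀ x → ¬ (P x × Q x) → ¬ P x ⊎ ¬ Q x
      cases x ¬pq with em {P x}
      ... | no ¬p = inj₁ ¬p
      ... | yes p = inj₂ λ q → ¬pq (p , q)

    Null⇒Almost¬ : ∀ {P} → Null P → Almost (λ x → ¬ P x)
    Null⇒Almost¬ = null-mono λ x → dne em

    Almost¬⇒Null : ∀ {P} → Almost (λ x → ¬ P x) → Null P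
    Almost¬⇒Null = null-mono λ x p ¬p → ¬p p

    positive-× : ∀ {P Q} → ¬ Null P → Almost Q → ¬ Null (λ x → P x × Q x)
    positive-× pos q null = pos (Almost¬⇒Null
      (almost-map (λ x (q , ¬pq) p → ¬pq (p , q)) (almost-× q (Null⇒Almost¬ null))))

    positive⇒∃ : ∀ {P} → ¬ Null P → K → ∃ P
    positive⇒∃ {P} pos ξ = dne em λ ¬e →
      pos (bounded (ξ , λ x m → ⊥-elim (¬e (x , ∈⁻ P m))))

    almost⇒∃ : ∀ {P} → Almost P → K → ∃ P
    almost⇒∃ {P} almost ξ = dne em λ ¬e →
      proper (downward (λ x _ → ∈⁺ (λ x → ¬ P x) λ p → ¬e (x , p)) almost)

    -- Weak saturation speaks of partitions. Points outside every `D t` go into the block of `t₀`;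
    -- blocks only grow, so they stay positive.
    weaklySaturated⇒¬disjoint : ∀ {τ t₀} → WeaklySaturated I τ → [ t₀ ] < τ → (D : K → Subset) →
      (∀ {s t α} → [ s ] < τ → [ t ] < τ → α ∈ D s → α ∈ D t → s ≡ t) →
      ¬ (∀ t → [ t ] < τ → ¬ I (D t))
    weaklySaturated⇒¬disjoint {τ} {t₀} saturated t₀<τ D unique positive =
      saturated (A , A-positive , A-disjoint , λ α → block α , block<τ α , ∈⁺ (λ α → block α ≡ block α) refl)
      where
      locate : ∀ α → ∃ λ t → [ t ] < τ × (∀ s → [ s ] < τ → α ∈ D s → t ≡ s)
      locate α with em {∃ λ t → [ t ] < τ × α ∈ D t}
      ... | yes (t , t<τ , α∈Dt) = t , t<τ , λ s s<τ α∈Ds → unique t<τ s<τ α∈Dt α∈Ds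
      ... | no ¬e = t₀ , t₀<τ , λ s s<τ α∈Ds → ⊥-elim (¬e (s , s<τ , α∈Ds))
      block : K → K
      block α = proj₁ (locate α)
      block<τ : ∀ α → [ block α ] < τ
      block<τ α = proj₁ (proj₂ (locate α))
      A : K → Subset
      A t = ｛ α ∣ block α ≡ t ｝
      A-positive : ∀ t → [ t ] < τ → ¬ I (A t)
      A-positive t t<τ null = positive t t<τ (downward
        (λ α α∈Dt → ∈⁺ (λ α → block α ≡ t) (proj₂ (proj₂ (locate α)) t t<τ α∈Dt)) null)
      A-disjoint : ∀ s t → [ s ] < τ → [ t ] < τ → s ≢ t → ∀ α → α ∈ A s → ¬ α ∈ A t
      A-disjoint s t _ _ s≢t α α∈As α∈At =
        s≢t (trans (sym (∈⁻ (λ α → block α ≡ s) α∈As)) (∈⁻ (λ α → block α ≡ t) α∈At))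

    weaklySaturated-mono : ∀ {μ τ t₀} → [ t₀ ] < μ → μ ≤ τ → WeaklySaturated I μ → WeaklySaturated I τ
    weaklySaturated-mono {μ} {τ} t₀<μ μ≤τ saturated (A , positive , disjoint , _) =
      weaklySaturated⇒¬disjoint saturated t₀<μ A unique (λ t t<μ → positive t (<-≤-trans t<μ μ≤τ))
      where
      unique : ∀ {s t α} → [ s ] < μ → [ t ] < μ → α ∈ A s → α ∈ A t → s ≡ t
      unique {s} {t} {α} s<μ t<μ α∈As α∈At = dne em λ s≢t →
        disjoint s t (<-≤-trans s<μ μ≤τ) (<-≤-trans t<μ μ≤τ) s≢t α α∈As α∈At

  module Wsat {θ t₀} (t₀<θ : [ t₀ ] < θ) (cardinal : IsCardinal θ) (saturated : WeaklySaturated I θ) where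

    private
      spec = least-spec (λ μ → IsCardinal μ × Elt (↓ μ) × WeaklySaturated I μ)
        (θ , cardinal , (t₀ , ↓⁺ {θ} t₀<θ) , saturated)

    opaque

      wsat≤ : wsat I ≤ θ
      wsat≤ = proj₂ spec θ (cardinal , (t₀ , ↓⁺ {θ} t₀<θ) , saturated)

      wsat≤⇒saturated : ∀ {τ} → wsat I ≤ τ → WeaklySaturated I τ
      wsat≤⇒saturated {τ} w≤τ =
        let (_ , (u , u∈) , sat) = proj₁ spec
        in weaklySaturated-mono (↓⁻ {wsat I} u∈) w≤τ sat

  -- Boundedness of functions into a regular cardinal.

  opaque

    gaps⇒¬positive : ∀ {τ t₀} → WeaklySaturated I τ → [ t₀ ] < τ → (f x y : K → K) →
      (∀ s t → s ≺ t → [ t ] < τ → y s ≺ x t) →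
      ¬ (∀ t → [ t ] < τ → ¬ Null (λ α → x t ≺ f α × f α ≼ y t))
    gaps⇒¬positive saturated t₀<τ f x y gap =
      weaklySaturated⇒¬disjoint saturated t₀<τ (λ t → comprehension (D t)) λ {s} {t} s<τ t<τ p q →
        let (xs≺f , f≼ys) = ∈⁻ (D s) p
            (xt≺f , f≼yt) = ∈⁻ (D t) q
        in intervals-unique gap s<τ t<τ xs≺f f≼ys xt≺f f≼yt
      where
      D : K → K → Set ℓ
      D t α = x t ≺ f α × f α ≼ y t

    -- If there is no bound, above each `i` there is a `j` such that `f` has values between them on
    -- a positive set; a chain of such intervals contradicts saturation. The point `α₀` shows that
    -- `τ` is nonempty.
    bounded-mod : ∀ {τ} → Bounds τ τ → WeaklySaturated I τ → Indecomposable I τ →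
      (f : K → K) → (∀ α → [ f α ] < τ) → K → ∃ λ i → [ i ] < τ × Almost (λ α → f α ≼ i)
    bounded-mod {τ} bounds saturated indecomposable f f<τ α₀ = dne em λ ¬bounded →
      let (ζ , ζ-spec) = skolem em id (step ¬bounded)
          (x , x<τ , gap , _) = chain bounds ζ id (λ i i<τ → proj₁ (ζ-spec i i<τ)) (λ _ p → p)
      in gaps⇒¬positive saturated (f<τ α₀) f x (ζ ∘ x) gap (λ t t<τ → proj₂ (ζ-spec (x t) (x<τ t t<τ)))
      where
      step : ¬ (∃ λ i → [ i ] < τ × Almost (λ α → f α ≼ i)) →
        ∀ i → [ i ] < τ → ∃ λ j → [ j ] < τ × ¬ Null (λ α → i ≺ f α × f α ≼ j)
      step ¬bounded i i<τ =
        -- The sets `A j` unite to the positive set where `f` exceeds `i`. Fewer than `τ` of them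
        -- suffice for a positive union, and by regularity their indices have a bound `y`.
        let (w , w⊆τ , w<τ , pos) = indecomposable A λ null → ¬bounded (i , i<τ , downward
              (λ α m → ∈⁺ (λ α → ∃ λ j → j ∈ ↓ τ × α ∈ A j)
                (f α , ↓⁺ {τ} (f<τ α) , ∈⁺ (λ α → i ≺ f α × f α ≡ f α)
                  (dne em (∈⁻ (λ α → ¬ f α ≼ i) m) , refl))) null)
            (y , y<τ , w≼y) = small⇒bounded bounds w⊆τ w<τ
        in y , y<τ , λ null → pos (downward (λ α m →
             let (j , j∈w , α∈Aj) = ∈⁻ (λ α → ∃ λ j → j ∈ w × α ∈ A j) m
                 (i≺fα , fα≡j) = ∈⁻ (λ α → i ≺ f α × f α ≡ j) α∈Aj
             in ∈⁺ (λ α → i ≺ f α × f α ≼ y) (i≺fα , subst (_≼ y) (sym fα≡j) (w≼y j j∈w))) null)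
        where
        A : K → Subset
        A j = ｛ α ∣ (i ≺ f α × f α ≡ j) ｝

-- Consequences of the regularity of `κ` and `θ`.

module Saturated {ℓ : Level} (em : ExcludedMiddle ℓ) (ext : Extensionality ℓ ℓ)
  (W : WellOrder ℓ) (κ-regular : Combinatorics.Regular em W ⊤⁺)
  (I : Combinatorics.Subset em W → Set ℓ) (isIdeal : Combinatorics.IsIdeal em W I)
  (θ : WellOrder.Carrier W) (θ-regular : Combinatorics.Regular em W [ θ ])
  (saturated : Combinatorics.WeaklySaturated em W I [ θ ])
  (indecomposable : Combinatorics.Indecomposable em W I [ θ ]) where

  open WellOrder W renaming (Carrier to K)
  open Combinatorics em W
  open AddSup _≺_ using ([_]<⊤⁺; [<]-injective) renaming ([_] to ↑)
  open Ordinals em ext W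
  open Ideals em ext W I isIdeal
  open IsIdeal isIdeal

  opaque

    regular⇒bounds : ∀ {ν} → Regular ν → Bounds ν ν
    regular⇒bounds {ν} (_ , _ , cf≡ν) = subst (λ μ → Bounds μ ν) cf≡ν (cf-bounds ν)

    κ-bounds : Bounds κ κ
    κ-bounds = regular⇒bounds κ-regular

    θ-bounds : Bounds [ θ ] [ θ ]
    θ-bounds = regular⇒bounds θ-regular

    θ-bounds-κ : Bounds [ θ ] κ
    θ-bounds-κ t _ = κ-bounds t [ t ]<⊤⁺

    θ-limit : ∀ t → [ t ] < [ θ ] → ∃ λ t′ → [ t′ ] < [ θ ] × t ≺ t′
    θ-limit = Infinite-limit (proj₁ (proj₂ θ-regular)) θ-bounds

    no-maximum : ∀ x → ∃ λ y → x ≺ y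
    no-maximum x = let (y , _ , x≺y) = Infinite-limit (proj₁ (proj₂ κ-regular)) κ-bounds x [ x ]<⊤⁺ in
      y , x≺y

    θ-inhabited : ∃ λ t → [ t ] < [ θ ]
    θ-inhabited = let (t , t∈θ) = Injection.to (proj₁ (proj₂ θ-regular)) 0 in t , ↓⁻ {[ θ ]} t∈θ

  t₀ : K
  t₀ = proj₁ θ-inhabited

  opaque

    t₀<θ : [ t₀ ] < [ θ ]
    t₀<θ = proj₂ θ-inhabited

    almost-above : ∀ ξ → Almost (ξ ≺_)
    almost-above ξ = let (ξ′ , ξ≺ξ′) = no-maximum ξ in
      bounded (ξ′ , λ x m → ↓⁺ {[ ξ′ ]} (↑ (≼-≺-trans (∈⁻ (λ x → ¬ ξ ≺ x) m) ξ≺ξ′)))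

  open Wsat {θ = [ θ ]} t₀<θ (proj₁ θ-regular) saturated

  -- Existence of a least function.

  Big : (K → K) → Set ℓ
  Big f = ∀ ξ → Almost (λ α → ξ ≺ f α)

  opaque

    -- Otherwise `θ` disjoint intervals with positive preimage under `g` could be chained. Where it
    -- exceeds the threshold `ξ`, `g` behaves like a big function.
    eventually-big : ∀ (g : K → K) → ∃ λ ξ → ∀ ζ → Null (λ α → ξ ≺ g α × g α ≼ ζ)
    eventually-big g = dne em λ ¬stable →
      let unstable ξ = ¬∀⇒∃¬ em {P = λ ζ → Null (λ α → ξ ≺ g α × g α ≼ ζ)} λ h → ¬stable (ξ , h)
          ζ ξ = proj₁ (unstable ξ)
          (x , _ , gap , _) = chain θ-bounds-κ ζ id (λ _ _ → [ _ ]<⊤⁺) (λ _ _ → [ _ ]<⊤⁺)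
      in gaps⇒¬positive saturated t₀<θ g x (ζ ∘ x) gap (λ t _ → proj₂ (unstable (x t)))

  Least : (K → K) → Set ℓ
  Least f = ∀ g → _<ᴵ_ I g f → BoundedMod I g

  opaque

    -- A `g` refuting leastness is replaced by `h` wherever it is at most the threshold `ξ`. This
    -- makes `f` big; `f` stays below `h` on a positive set because `g` is unbounded modulo `I`.
    descend : ∀ h → Big h → ¬ Least h → ∃ λ (f : K → K) → Big f × ¬ Null (λ α → f α ≺ h α)
    descend h big ¬least with ¬∀⇒∃¬ em {P = λ g → _<ᴵ_ I g h → BoundedMod I g} ¬least
    ... | g , ¬g with eventually-big g
    ... | ξ , stable = f , f-big , f-below
      where
      glue : ∀ α → ∃ λ y → (ξ ≺ g α × y ≡ g α) ⊎ (g α ≼ ξ × y ≡ h α)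
      glue α with em {ξ ≺ g α}
      ... | yes p = g α , inj₁ (p , refl)
      ... | no ¬p = h α , inj₂ (¬p , refl)
      f : K → K
      f α = proj₁ (glue α)
      f-big : Big f
      f-big ζ = almost-map above (almost-× (big ζ) (Null⇒Almost¬ (stable ζ)))
        where
        above : ∀ α → ζ ≺ h α × ¬ (ξ ≺ g α × g α ≼ ζ) → ζ ≺ f α
        above α (ζ≺h , ¬mid) with proj₂ (glue α)
        ... | inj₁ (ξ≺g , f≡g) = subst (ζ ≺_) (sym f≡g) (dne em λ g≼ζ → ¬mid (ξ≺g , g≼ζ))
        ... | inj₂ (_ , f≡h) = subst (ζ ≺_) (sym f≡h) ζ≺h
      f-below : ¬ Null (λ α → f α ≺ h α)
      f-below null = ¬g λ g<h → ξ , Almost¬⇒Null (almost-map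
        (λ α (g≺h , f≮h) ξ≺g → f≮h (below α g≺h ξ≺g))
        (almost-× g<h (Null⇒Almost¬ null)))
        where
        below : ∀ α → g α ≺ h α → ξ ≺ g α → f α ≺ h α
        below α g≺h ξ≺g with proj₂ (glue α)
        ... | inj₁ (_ , f≡g) = subst (_≺ h α) (sym f≡g) g≺h
        ... | inj₂ (g≼ξ , _) = ⊥-elim (g≼ξ ξ≺g)

  -- The member `α` guarantees an element above any given `ξ`, for almost all `α`.
  Values : K → (K → K → K) → K → K → Set ℓ
  Values i r α v = v ≡ α ⊎ ∃ λ s → s ≺ i × v ≡ r s α

  opaque

    -- h is the junk value α when A has no element above ξ.
    minimum-above : (A : K → Set ℓ) → ∀ ξ α → ∃ λ h →
      (∀ v → A v → ξ ≺ v → h ≼ v) × (A α → ξ ≺ α → A h × ξ ≺ h)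
    minimum-above A ξ α with em {∃ λ v → A v × ξ ≺ v}
    ... | yes e = let (h , p , min) = minimum (λ v → A v × ξ ≺ v) e in
      h , (λ v a ξ≺v → min v (a , ξ≺v)) , λ _ _ → p
    ... | no ¬e = α , (λ v a ξ≺v → ⊥-elim (¬e (v , a , ξ≺v))) , λ a ξ≺α → ⊥-elim (¬e (α , a , ξ≺α))

  module _ (i : K) (i<θ : [ i ] < [ θ ]) (r : K → K → K) where

    private
      H : K → K → K
      H ξ α = proj₁ (minimum-above (Values i r α) ξ α)

      H-min : ∀ ξ α v → Values i r α v → ξ ≺ v → H ξ α ≼ v
      H-min ξ α = proj₁ (proj₂ (minimum-above (Values i r α) ξ α))

      H-value : ∀ ξ α → ξ ≺ α → Values i r α (H ξ α) × ξ ≺ H ξ α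
      H-value ξ α = proj₂ (proj₂ (minimum-above (Values i r α) ξ α)) (inj₁ refl)

      module Contradiction (small : ∀ ξ → ∃ λ ζ → ¬ Almost (λ α → ζ ≺ H ξ α)) where

        ζ : K → K
        ζ ξ = proj₁ (small ξ)

        levels : ∃ λ (x : K → K) → (∀ t → [ t ] < [ θ ] → [ x t ] < κ) ×
          (∀ s t → s ≺ t → [ t ] < [ θ ] → ζ (x s) ≺ x t) × (∀ t → [ t ] < [ θ ] → t ≼ x t)
        levels = chain θ-bounds-κ ζ id (λ _ _ → [ _ ]<⊤⁺) (λ _ _ → [ _ ]<⊤⁺)

        x : K → K
        x = proj₁ levels

        Hit : K → K → Set ℓ
        Hit v t = [ t ] < [ θ ] × x t ≺ v × v ≼ ζ (x t)

        hit-bound : ∀ v → ∃ λ m → [ m ] < [ θ ] × (∀ t → Hit v t → t ≺ m)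
        hit-bound v with em {∃ (Hit v)}
        ... | no ¬e = t₀ , t₀<θ , λ t hit → ⊥-elim (¬e (t , hit))
        ... | yes (s , s<θ , xs≺v , v≼ys) = let (m , m<θ , s≺m) = θ-limit s s<θ in
          m , m<θ , λ t (t<θ , xt≺v , v≼yt) →
            subst (_≺ m) (intervals-unique (proj₁ (proj₂ (proj₂ levels))) s<θ t<θ xs≺v v≼ys xt≺v v≼yt) s≺m

        -- Each of the fewer than `θ` values lies in at most one of the disjoint intervals, so
        -- regularity of `θ` bounds the indices.
        hits-bound : ∀ α → ∃ λ m → [ m ] < [ θ ] × (∀ t v → Values i r α v → Hit v t → t ≺ m)
        hits-bound α =
          let (m₁ , m₁<θ , hit≺m₁) = hit-bound α
              (m₂ , m₂<θ , hits≺m₂) = θ-bounds i i<θ (λ s → proj₁ (hit-bound (r s α)))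
                (λ s _ → proj₁ (proj₂ (hit-bound (r s α))))
              (m , m<θ , m₁≼m , m₂≼m) = upper m₁ m₂ m₁<θ m₂<θ
          in m , m<θ , λ where
            t _ (inj₁ refl) hit → ≺-≼-trans (hit≺m₁ t hit) m₁≼m
            t _ (inj₂ (s , s≺i , refl)) hit → ≺-≼-trans
              (≺.trans (proj₂ (proj₂ (hit-bound (r s α))) t hit) (hits≺m₂ s s≺i)) m₂≼m

        contradiction : ⊥
        contradiction =
          -- One `t` bounds the hits at almost all `α`, so `H (x t)` almost never lies in interval
          -- `t`, against the choice of `ζ`. The last argument `θ` is just some point of `K`.
          let (t , t<θ , m≼t) = bounded-mod θ-bounds saturated indecomposable
                (λ α → proj₁ (hits-bound α)) (λ α → proj₁ (proj₂ (hits-bound α))) θ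
          in proj₂ (small (x t)) (almost-map
            (λ α (m≼t , xt≺α) → dne em λ H≼ζ →
              let (value , xt≺H) = H-value (x t) α xt≺α
              in m≼t (proj₂ (proj₂ (hits-bound α)) t _ value (t<θ , xt≺H , H≼ζ)))
            (almost-× m≼t (almost-above (x t))))

    opaque

      -- This supplies `descend` with a big function at every stage.
      big-minimum : ∃ λ ξ → ∃ λ (h : K → K) → Big h × (∀ α v → Values i r α v → ξ ≺ v → h α ≼ v)
      big-minimum = dne em λ ¬big → Contradiction.contradiction λ ξ →
        ¬∀⇒∃¬ em λ big → ¬big (ξ , H ξ , big , H-min ξ)

  module Descent (¬least : ∀ f → Big f → ¬ Least f) where

    Dominated : K → (K → K → K) → (K → K) → K → Set ℓ
    Dominated i r f ξ = ∃ λ (h : K → K) →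
      (∀ α v → Values i r α v → ξ ≺ v → h α ≼ v) × ¬ Null (λ α → f α ≺ h α)

    Next : K → (K → K → K) → (K → K) → Set ℓ
    Next i r f = [ i ] < [ θ ] → Big f × ∃ (Dominated i r f)

    next : ∀ i r → ∃ (Next i r)
    next i r with em {[ i ] < [ θ ]}
    ... | no i≮θ = id , λ i<θ → ⊥-elim (i≮θ i<θ)
    ... | yes i<θ =
      let (ξ , h , h-big , h-min) = big-minimum i i<θ r
          (f , f-big , f-below) = descend h h-big (¬least h h-big)
      in f , λ _ → f-big , ξ , h , h-min , f-below

    sequence : ∃ λ (f : K → K → K) → ∀ i → ∃ λ r → (∀ s → s ≺ i → r s ≡ f s) × Next i r (f i)
    sequence = transfinite Next (λ _ → id) next

    f : K → K → K
    f = proj₁ sequence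

    f-next : ∀ i → Next i f (f i)
    f-next i i<θ =
      let (r , r≡f , n) = proj₂ sequence i
          (f-big , ξ , h , h-min , f-below) = n i<θ
          values : ∀ α v → Values i f α v → Values i r α v
          values α v = λ where
            (inj₁ v≡α) → inj₁ v≡α
            (inj₂ (s , s≺i , v≡fs)) → inj₂ (s , s≺i , trans v≡fs (cong (λ g → g α) (sym (r≡f s s≺i))))
      in f-big , ξ , h , (λ α v value → h-min α v (values α v value)) , f-below

    choice : ∃ λ (ξ : K → K) → ∀ i → [ i ] < [ θ ] → Dominated i f (f i) (ξ i)
    choice = skolem em id (λ i i<θ → proj₂ (f-next i i<θ))

    sup : ∃ λ y → [ y ] < κ × (∀ i → i ≺ θ → proj₁ choice i ≺ y)
    sup = κ-bounds θ [ θ ]<⊤⁺ (proj₁ choice) (λ _ _ → [ _ ]<⊤⁺)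

    ξ* : K
    ξ* = proj₁ sup

    least-value : ∀ α → ∃ λ m →
      (∀ v → Values θ f α v → ξ* ≺ v → m ≼ v) × (Values θ f α α → ξ* ≺ α → Values θ f α m × ξ* ≺ m)
    least-value α = minimum-above (Values θ f α) ξ* α

    m : K → K
    m α = proj₁ (least-value α)

    -- `s` is a stage at which `m α` is attained, or `t₀` if `m α` can only be `α` itself.
    stage : ∀ α → ∃ λ s → [ s ] < [ θ ] ×
      (∀ i → [ i ] < [ θ ] → s ≺ i → Values θ f α (m α) → Values i f α (m α))
    stage α with em {∃ λ s → [ s ] < [ θ ] × m α ≡ f s α}
    ... | yes (s , s<θ , m≡fs) = s , s<θ , λ i _ s≺i _ → inj₂ (s , s≺i , m≡fs)
    ... | no ¬e = t₀ , t₀<θ , λ where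
      i _ _ (inj₁ m≡α) → inj₁ m≡α
      i _ _ (inj₂ (s , s≺θ , m≡fs)) → ⊥-elim (¬e (s , ↑ s≺θ , m≡fs))

    contradiction : ⊥
    contradiction =
      -- Almost everywhere the minimum is attained by stage `i₀`, so the later stage `i` already
      -- sees the overall minimum.
      let (i₀ , i₀<θ , stage≼i₀) = bounded-mod θ-bounds saturated indecomposable
            (λ α → proj₁ (stage α)) (λ α → proj₁ (proj₂ (stage α))) θ
          (i , i<θ , i₀≺i) = θ-limit i₀ i₀<θ
          (h , h-min , f-below) = proj₂ choice i i<θ
          (α , (((f≺h , stage≼i₀) , ξ*≺f) , ξ*≺α)) = positive⇒∃
            (positive-× (positive-× (positive-× f-below stage≼i₀) (proj₁ (f-next i i<θ) ξ*))
              (almost-above ξ*)) θ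
          (m-value , ξ*≺m) = proj₂ (proj₂ (least-value α)) (inj₁ refl) ξ*≺α
          m≼f = proj₁ (proj₂ (least-value α)) (f i α) (inj₂ (i , [<]-injective i<θ , refl)) ξ*≺f
          m-value-i = proj₂ (proj₂ (stage α)) i i<θ (≼-≺-trans stage≼i₀ i₀≺i) m-value
          -- `h-min` applies since `ξ*` exceeds the threshold of stage `i`.
          h≼m = h-min α (m α) m-value-i (≺.trans (proj₂ (proj₂ sup) i ([<]-injective i<θ)) ξ*≺m)
      in ≼-trans h≼m m≼f f≺h

  least-function : ∃ λ (f : K → K) → Big f × Least f
  least-function = dne em λ ¬e → Descent.contradiction λ f big least → ¬e (f , big , least)

  -- Suprema of `θ`-sequences and stationarity of `S* I`.

  opaque

    -- A `ζ` that steps into a club makes `δ` a limit point of it; a `ζ` that dominates a function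
    -- on initial segments makes `δ` closed under that function.
    θ-sup : (ζ : K → K) → (∀ ξ → ξ ≺ ζ ξ) → ∀ ξ₀ → ∃ λ δ → ∃ λ (x : K → K) →
      ξ₀ ≺ δ × (∀ t → [ t ] < [ θ ] → ζ (x t) ≺ δ) ×
      (∀ η → η ≺ δ → ∃ λ t → [ t ] < [ θ ] × η ≺ x t) ×
      (∀ s t → s ≺ t → [ t ] < [ θ ] → x s ≺ x t)
    θ-sup ζ ζ-inflationary ξ₀
      with chain θ-bounds-κ ζ (λ _ → ξ₀) (λ _ _ → [ _ ]<⊤⁺) (λ _ _ → [ _ ]<⊤⁺)
    ... | x , _ , gap , above with κ-bounds θ [ θ ]<⊤⁺ x (λ _ _ → [ _ ]<⊤⁺)
    ... | y , _ , x≺y with minimum (λ y → ∀ t → [ t ] < [ θ ] → x t ≺ y)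
      (y , λ t t<θ → x≺y t ([<]-injective t<θ))
    ... | δ , x≺δ , δ-min =
      δ , x , ≼-≺-trans (above t₀ t₀<θ) (x≺δ t₀ t₀<θ) , ζx≺δ , cofinal , increasing
      where
      increasing : ∀ s t → s ≺ t → [ t ] < [ θ ] → x s ≺ x t
      increasing s t s≺t t<θ = ≺.trans (ζ-inflationary (x s)) (gap s t s≺t t<θ)
      ζx≺δ : ∀ t → [ t ] < [ θ ] → ζ (x t) ≺ δ
      ζx≺δ t t<θ = let (t′ , t′<θ , t≺t′) = θ-limit t t<θ in ≺.trans (gap t t′ t≺t′ t′<θ) (x≺δ t′ t′<θ)
      cofinal : ∀ η → η ≺ δ → ∃ λ t → [ t ] < [ θ ] × η ≺ x t
      cofinal η η≺δ = dne em λ ¬e → δ-min η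
        (λ t t<θ → dne em λ η≼xt → let (t′ , t′<θ , t≺t′) = θ-limit t t<θ in
          ¬e (t′ , t′<θ , ≼-≺-trans η≼xt (increasing t t′ t≺t′ t′<θ))) η≺δ

    -- A cofinal map from some `i ≺ θ` would yield indices `T s` unbounded in `θ`, against
    -- regularity.
    cf-θ-sup : ∀ {δ} {x : K → K} → (∀ t → [ t ] < [ θ ] → x t ≺ δ) →
      (∀ η → η ≺ δ → ∃ λ t → [ t ] < [ θ ] × η ≺ x t) →
      (∀ s t → s ≺ t → [ t ] < [ θ ] → x s ≺ x t) → cf [ δ ] ≡ [ θ ]
    cf-θ-sup {δ} {x} x≺δ x-cofinal increasing = equal (cf-≤ cofinal-x) (≮⇒≥ not-shorter)
      where
      cofinal-x : CofinalMap [ θ ] [ δ ]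
      cofinal-x = x , (λ t t<θ → ↑ (x≺δ t t<θ)) , λ ξ ξ<δ →
        let (t , t<θ , ξ≺xt) = x-cofinal ξ ([<]-injective ξ<δ) in t , t<θ , inj₁ (↑ ξ≺xt)
      no-shorter : ∀ {μ} → μ < [ θ ] → ¬ CofinalMap μ [ δ ]
      no-shorter (↑ {k = i} i≺θ) (c , c<δ , c-cofinal) =
        let (T , T-spec) = skolem em {P = λ s → s ≺ i} id
              (λ s s≺i → x-cofinal (c s) ([<]-injective (c<δ s (↑ s≺i))))
            (t , t<θ , T≺t) = θ-bounds i (↑ i≺θ) T (λ s s≺i → proj₁ (T-spec s s≺i))
            (s , s<i , xt≤cs) = c-cofinal (x t) (↑ (x≺δ t t<θ))
            s≺i = [<]-injective s<i
        in ≤⇒≼ xt≤cs (≺.trans (proj₂ (T-spec s s≺i)) (increasing (T s) t (T≺t s s≺i) t<θ))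
      not-shorter : ¬ cf [ δ ] < [ θ ]
      not-shorter cf<θ = no-shorter cf<θ (cf-cofinal [ δ ])
      equal : ∀ {μ ν} → μ ≤ ν → ν ≤ μ → μ ≡ ν
      equal (inj₂ μ≡ν) _ = μ≡ν
      equal (inj₁ μ<ν) ν≤μ = ⊥-elim (≤⇒≯ ν≤μ μ<ν)

  -- The cofinality is a separate argument so that `cf [ δ ] ≡ [ θ ]` can be substituted.
  InS* : K → Ord → Set ℓ
  InS* α τ = wsat I ≤ τ × τ < [ α ] × indec I τ

  opaque

    stationary-S* : Stationary (S* I) κ
    stationary-S* = (λ x _ → ↓⁺ {κ} [ x ]<⊤⁺) , meets
      where
      meets : ∀ C → Club C κ → ∃ λ δ → δ ∈ S* I × δ ∈ C
      meets C (_ , unbounded , closed) = δ , δ∈S* , closed δ [ δ ]<⊤⁺ limit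
        where
        above : ∀ ξ → ∃ λ η → η ∈ C × ξ ≺ η
        above ξ = let (ξ′ , ξ≺ξ′) = no-maximum ξ
                      (η , η∈C , ξ′≤η , _) = unbounded ξ′ [ ξ′ ]<⊤⁺
                  in η , η∈C , ≺-≼-trans ξ≺ξ′ (≤⇒≼ ξ′≤η)
        ζ : K → K
        ζ ξ = proj₁ (above ξ)
        ζ-inflationary : ∀ ξ → ξ ≺ ζ ξ
        ζ-inflationary ξ = proj₂ (proj₂ (above ξ))
        sup : ∃ λ δ → ∃ λ (x : K → K) → θ ≺ δ × (∀ t → [ t ] < [ θ ] → ζ (x t) ≺ δ) ×
          (∀ η → η ≺ δ → ∃ λ t → [ t ] < [ θ ] × η ≺ x t) ×
          (∀ s t → s ≺ t → [ t ] < [ θ ] → x s ≺ x t)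
        -- Starting above `θ` gives `cf [ δ ] < [ δ ]`.
        sup = θ-sup ζ ζ-inflationary θ
        δ : K
        δ = proj₁ sup
        δ∈S* : δ ∈ S* I
        δ∈S* = let (_ , x , θ≺δ , ζx≺δ , cofinal , increasing) = sup in
          ∈⁺ (λ α → InS* α (cf [ α ])) (subst (InS* δ)
            (sym (cf-θ-sup (λ t t<θ → ≺.trans (ζ-inflationary (x t)) (ζx≺δ t t<θ)) cofinal increasing))
            (wsat≤ , ↑ θ≺δ , [ θ ]<⊤⁺ , indecomposable))
        limit : LimitPoint C δ
        limit = let (_ , x , θ≺δ , ζx≺δ , cofinal , _) = sup in
          (θ , θ≺δ) , λ ξ ξ≺δ → let (t , t<θ , ξ≺xt) = cofinal ξ ξ≺δ in
            ζ (x t) , proj₁ (proj₂ (above (x t))) , ≺.trans ξ≺xt (ζ-inflationary (x t)) , ζx≺δ t t<θ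

  -- Stationary traces below a least function.

  module _ (f : K → K) (f-big : Big f) (f-least : Least f) where

    module _ (S : Subset) (S-stationary : Stationary S κ) (S⊆S* : S ⊆ S* I) where

      private
        Bad : K → Set ℓ
        Bad α = ¬ Stationary (S ∩ ↓ [ f α ]) [ f α ]

        Avoids : K → Subset → Set ℓ
        Avoids α C = Club C [ f α ] × (∀ δ → δ ∈ S → ¬ δ ∈ C)

        opaque

          bad⇒avoids : ∀ α → Bad α → ∃ (Avoids α)
          bad⇒avoids α bad = dne em λ ¬e → bad
            ((λ x m → proj₂ (Equivalence.to (T-∧ {S x}) m)) , λ C club → dne em λ ¬meet →
              ¬e (C , club , λ δ δ∈S δ∈C →
                ¬meet (δ , Equivalence.from T-∧ (δ∈S , proj₁ club δ δ∈C) , δ∈C)))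

          avoiding : ∃ λ (C : K → Subset) → ∀ α → Bad α → Avoids α (C α)
          avoiding = skolem em (λ _ → full) bad⇒avoids

        C : K → Subset
        C = proj₁ avoiding

        Hits : K → K → K → Set ℓ
        Hits ξ ζ α = Bad α → ∃ λ η → η ∈ C α × ξ ≺ η × η ≺ ζ

        opaque

          next-point : ∀ ξ ξ′ → ξ ≺ ξ′ → ∀ α → ξ′ ≺ f α →
            ∃ λ η → η ≺ f α × (Bad α → η ∈ C α × ξ ≺ η)
          next-point ξ ξ′ ξ≺ξ′ α ξ′≺f with em {Bad α}
          -- At the other `α` any value below `f α` serves.
          ... | no ¬bad = ξ , ≺.trans ξ≺ξ′ ξ′≺f , λ bad → ⊥-elim (¬bad bad)
          ... | yes bad with proj₁ (proj₂ avoiding α bad)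
          -- `Unbounded` gives a weak inequality over `ξ′`, hence a strict one over `ξ`.
          ... | _ , unbounded , _ with unbounded ξ′ (↑ ξ′≺f)
          ... | η , η∈C , ξ′≤η , η<f =
            η , [<]-injective η<f , λ _ → η∈C , ≺-≼-trans ξ≺ξ′ (≤⇒≼ ξ′≤η)

          -- The chosen points `g α` of `C α` lie below `f α` almost everywhere, so leastness bounds
          -- `g` modulo `I`.
          hits : ∀ ξ → ∃ λ ζ → ξ ≺ ζ × Almost (Hits ξ ζ)
          hits ξ with no-maximum ξ
          ... | ξ′ , ξ≺ξ′ with skolem em id (next-point ξ ξ′ ξ≺ξ′)
          ... | g , g-spec with f-least g (almost-map (λ α ξ′≺f → proj₁ (g-spec α ξ′≺f)) (f-big ξ′))
          ... | ζ₀ , g≼ζ₀ with upper {κ} ξ ζ₀ [ ξ ]<⊤⁺ [ ζ₀ ]<⊤⁺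
          ... | ζ₁ , _ , ξ≼ζ₁ , ζ₀≼ζ₁ with no-maximum ζ₁
          ... | ζ , ζ₁≺ζ =
            ζ , ≼-≺-trans ξ≼ζ₁ ζ₁≺ζ , almost-map hit (almost-× (f-big ξ′) (Null⇒Almost¬ g≼ζ₀))
            where
            hit : ∀ α → ξ′ ≺ f α × g α ≼ ζ₀ → Hits ξ ζ α
            hit α (ξ′≺f , gα≼ζ₀) bad = let (g∈C , ξ≺g) = proj₂ (g-spec α ξ′≺f) bad in
              g α , g∈C , ξ≺g , ≼-≺-trans gα≼ζ₀ (≼-≺-trans ζ₀≼ζ₁ ζ₁≺ζ)

        ζ : K → K
        ζ ξ = proj₁ (hits ξ)

        Closed : K → Set ℓ
        Closed δ = (∃ λ ξ → ξ ≺ δ) × (∀ ξ → ξ ≺ δ → ζ ξ ≺ δ)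

        opaque

          -- `ζ` need not be monotone, so the supremum is taken for a dominating `G`: from `η ≺ x t`
          -- follows `ζ η ≼ G (x t) ≺ δ`.
          closed-club : Club (comprehension Closed) κ
          closed-club = (λ x _ → ↓⁺ {κ} [ x ]<⊤⁺) , unbounded , closed
            where
            G-choice : ∃ λ (G : K → K) → ∀ β → [ β ] < κ → [ G β ] < κ × (∀ i → i ≼ β → ζ i ≼ G β)
            G-choice = skolem em id (dominating κ-bounds ζ (λ _ _ → [ _ ]<⊤⁺))
            G : K → K
            G = proj₁ G-choice
            G-dominates : ∀ i β → i ≼ β → ζ i ≼ G β
            G-dominates i β = proj₂ (proj₂ G-choice β [ β ]<⊤⁺) i
            unbounded : Unbounded (comprehension Closed) κ
            unbounded ξ _ =
              let (δ , x , ξ≺δ , Gx≺δ , cofinal , _) = θ-sup G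
                    (λ ξ → ≺-≼-trans (proj₁ (proj₂ (hits ξ))) (G-dominates ξ ξ ≺-irrefl)) ξ
              in δ , ∈⁺ Closed ((ξ , ξ≺δ) , λ η η≺δ → let (t , t<θ , η≺xt) = cofinal η η≺δ in
                   ≼-≺-trans (G-dominates η (x t) (≺⇒≼ η≺xt)) (Gx≺δ t t<θ)) ,
                 inj₁ (↑ ξ≺δ) , [ δ ]<⊤⁺
            closed : ∀ δ → [ δ ] < κ → LimitPoint (comprehension Closed) δ → δ ∈ comprehension Closed
            closed δ _ (nonempty , limit) = ∈⁺ Closed (nonempty , λ ξ ξ≺δ →
              let (η , η∈E , ξ≺η , η≺δ) = limit ξ ξ≺δ
              in ≺.trans (proj₂ (∈⁻ Closed η∈E) ξ ξ≺η) η≺δ)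

          -- `τ` stands for `cf [ δ ]`. If `Bad` were positive, `δ` would be a limit point of `C α`
          -- for some bad `α`, hence an element, although `C α` avoids `S`.
          bad-null-at : ∀ {δ τ} → δ ∈ S → Closed δ → CofinalMap τ [ δ ] → Bounds τ [ δ ] →
            WeaklySaturated I τ → Indecomposable I τ → Null Bad
          bad-null-at {δ} {τ} δ∈S ((ξ₀ , ξ₀≺δ) , ζ-closed) (c , c<δ , c-cofinal) bounds sat indecomp =
            dne em ¬¬null
            where
            levels : ∃ λ (x : K → K) → (∀ t → [ t ] < τ → [ x t ] < [ δ ]) ×
              (∀ s t → s ≺ t → [ t ] < τ → x s ≺ x t) × (∀ t → [ t ] < τ → c t ≼ x t)
            levels = chain bounds id c (λ _ p → p) c<δ
            x : K → K
            x = proj₁ levels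
            x-mono : ∀ {s t} → [ t ] < τ → s ≼ t → x s ≼ x t
            x-mono {s} {t} t<τ s≼t with ≺.compare s t
            ... | tri< s≺t _ _ = ≺⇒≼ (proj₁ (proj₂ (proj₂ levels)) s t s≺t t<τ)
            ... | tri≈ _ refl _ = ≺-irrefl
            ... | tri> _ _ t≺s = ⊥-elim (s≼t t≺s)
            BoundedBelow : K → K → Set ℓ
            BoundedBelow α ξ = ∀ η → η ∈ C α → η ≺ δ → η ≼ ξ
            -- Bounds below `δ` are rounded up to terms of the cofinal sequence `x`, so that
            -- `bounded-mod` gives one index for almost all `α`.
            level : ∀ α → ∃ λ t → [ t ] < τ × (∀ ξ → ξ ≺ δ → BoundedBelow α ξ → BoundedBelow α (x t))
            level α with em {∃ λ ξ → ξ ≺ δ × BoundedBelow α ξ}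
            ... | no ¬e = let (t , t<τ , _) = c-cofinal ξ₀ (↑ ξ₀≺δ) in
              t , t<τ , λ ξ ξ≺δ below → ⊥-elim (¬e (ξ , ξ≺δ , below))
            ... | yes (ξ , ξ≺δ , below) = let (t , t<τ , ξ≤ct) = c-cofinal ξ (↑ ξ≺δ) in
              t , t<τ , λ _ _ _ η η∈C η≺δ →
                ≼-trans (below η η∈C η≺δ) (≼-trans (≤⇒≼ ξ≤ct) (proj₂ (proj₂ (proj₂ levels)) t t<τ))
            level-bound : ∃ λ i → [ i ] < τ × Almost (λ α → proj₁ (level α) ≼ i)
            level-bound = bounded-mod (cofinal⇒regular (c , c<δ , c-cofinal) bounds) sat indecomp
              (λ α → proj₁ (level α)) (λ α → proj₁ (proj₂ (level α))) θ
            i : K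
            i = proj₁ level-bound
            i<τ : [ i ] < τ
            i<τ = proj₁ (proj₂ level-bound)
            refute : ∀ α → Bad α → proj₁ (level α) ≼ i → Hits (x i) (ζ (x i)) α → δ ≺ f α → ⊥
            refute α bad level≼i hit δ≺f =
              proj₂ (proj₂ avoiding α bad) δ δ∈S
                (proj₂ (proj₂ (proj₁ (proj₂ avoiding α bad))) δ (↑ δ≺f) ((ξ₀ , ξ₀≺δ) , limit))
              where
              xi<δ : [ x i ] < [ δ ]
              xi<δ = proj₁ (proj₂ levels) i i<τ
              not-bounded : ∀ ξ → ξ ≺ δ → ¬ BoundedBelow α ξ
              not-bounded ξ ξ≺δ below =
                -- As `δ` is closed under `ζ`, this point of `C α` above `x i` is still below `δ`.
                let (η , η∈C , xi≺η , η≺ζ) = hit bad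
                in ≼-trans (proj₂ (proj₂ (level α)) ξ ξ≺δ below η η∈C
                     (≺.trans η≺ζ (ζ-closed (x i) ([<]-injective xi<δ)))) (x-mono i<τ level≼i) xi≺η
              limit : ∀ ξ → ξ ≺ δ → ∃ λ η → η ∈ C α × ξ ≺ η × η ≺ δ
              limit ξ ξ≺δ = dne em λ ¬e → not-bounded ξ ξ≺δ λ η η∈C η≺δ ξ≺η → ¬e (η , η∈C , ξ≺η , η≺δ)
            ¬¬null : ¬ ¬ Null Bad
            ¬¬null pos =
              let (α , ((bad , level≼i) , hit) , δ≺f) = positive⇒∃ (positive-× (positive-× (positive-× pos
                    (proj₂ (proj₂ level-bound))) (proj₂ (proj₂ (hits (x i))))) (f-big δ)) θ
              in refute α bad level≼i hit δ≺f

      opaque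

        almost-reflects : AlmostAll I (λ α → Stationary (S ∩ ↓ [ f α ]) [ f α ])
        almost-reflects =
          let (δ , δ∈S , δ∈E) = proj₂ S-stationary (comprehension Closed) closed-club
              (wsat≤cf , _ , _ , indecomp) = ∈⁻ (λ α → InS* α (cf [ α ])) (S⊆S* δ δ∈S)
          in bad-null-at δ∈S (∈⁻ Closed δ∈E) (cf-cofinal [ δ ]) (cf-bounds [ δ ])
               (wsat≤⇒saturated wsat≤cf) indecomp

  -- Limit ordinals and uncountable cofinality.

  DenseBelow : K → Set ℓ
  DenseBelow δ = ∀ ξ → ξ ≺ δ → ∃ λ η → ξ ≺ η × η ≺ δ

  IsLimit : K → Set ℓ
  IsLimit δ = (∃ λ ξ → ξ ≺ δ) × DenseBelow δ

  opaque

    successor : ∀ x → ∃ λ y → x ≺ y × (∀ z → x ≺ z → y ≼ z)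
    successor x = minimum (x ≺_) (no-maximum x)

  suc⁺ : K → K
  suc⁺ x = proj₁ (successor x)

  opaque

    ≺-suc : ∀ x → x ≺ suc⁺ x
    ≺-suc x = proj₁ (proj₂ (successor x))

    suc-≼ : ∀ {x y} → x ≺ y → suc⁺ x ≼ y
    suc-≼ {x} {y} = proj₂ (proj₂ (successor x)) y

    -- Where `f α` is a successor, its predecessor gives a smaller function, bounded modulo `I` by
    -- some `ζ`; then `f α ≼ suc⁺ ζ`, which bigness excludes almost everywhere.
    least⇒almost-limit : ∀ f → Big f → Least f → Almost (λ α → IsLimit (f α))
    least⇒almost-limit f f-big f-least =
      let (g , g-spec) = skolem em (λ _ → θ) predecessor
          (ζ , g≼ζ) = f-least g (almost-map (λ α θ≺f → proj₁ (g-spec α θ≺f)) (f-big θ))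
      in almost-map (λ α (θ≺f , ¬ζ≺g , ζ′≺f) → (θ , θ≺f) , dne em λ ¬dense →
           proj₂ (g-spec α θ≺f) ¬dense (suc⁺ ζ) (≼-≺-trans ¬ζ≺g (≺-suc ζ)) ζ′≺f)
         (almost-× (f-big θ) (almost-× (Null⇒Almost¬ g≼ζ) (f-big (suc⁺ ζ))))
      where
      predecessor : ∀ α → θ ≺ f α → ∃ λ β → β ≺ f α × (¬ DenseBelow (f α) → ∀ η → β ≺ η → f α ≼ η)
      predecessor α θ≺f with em {∃ λ β → β ≺ f α × (∀ η → β ≺ η → f α ≼ η)}
      ... | yes (β , β≺f , above) = β , β≺f , λ _ → above
      ... | no ¬e = θ , θ≺f , λ ¬dense → ⊥-elim (¬dense λ ξ ξ≺f → dne em λ ¬η →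
        ¬e (ξ , ξ≺f , λ η ξ≺η η≺f → ¬η (η , ξ≺η , η≺f)))

    -- A successor has cofinality at most 1, so it would make `I` weakly 1-saturated; the single
    -- block `full` refutes this.
    S*⇒dense : ∀ δ → δ ∈ S* I → DenseBelow δ
    S*⇒dense δ δ∈S* β β≺δ = dne em λ ¬dense →
      -- `o` is the ordinal 0 and `suc⁺ o` is 1.
      let (o , _ , o-min) = minimum (λ x → x ≡ x) (θ , refl)
          wsat≤cf = proj₁ (∈⁻ (λ α → InS* α (cf [ α ])) δ∈S*)
          sat = wsat≤⇒saturated (≤-trans wsat≤cf (cf-≤ (single ¬dense o)))
      in weaklySaturated⇒¬disjoint sat (↑ (≺-suc o)) (λ _ → full)
           (λ s<1 t<1 _ _ → trans (only o o-min s<1) (sym (only o o-min t<1))) (λ _ _ → proper)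
      where
      single : ¬ (∃ λ η → β ≺ η × η ≺ δ) → ∀ o → CofinalMap [ suc⁺ o ] [ δ ]
      single ¬dense o = (λ _ → β) , (λ _ _ → ↑ β≺δ) , λ ξ ξ<δ →
        o , ↑ (≺-suc o) , ≼⇒≤ λ β≺ξ → ¬dense (ξ , β≺ξ , [<]-injective ξ<δ)
      only : ∀ o → (∀ y → y ≡ y → o ≼ y) → ∀ {s} → [ s ] < [ suc⁺ o ] → s ≡ o
      only o o-min {s} s<1 with ≺.compare s o
      ... | tri< s≺o _ _ = ⊥-elim (o-min s refl s≺o)
      ... | tri≈ _ s≡o _ = s≡o
      ... | tri> _ _ o≺s = ⊥-elim (suc-≼ o≺s ([<]-injective s<1))

    -- The successors of the terms of a cofinal ω-sequence form a club without limit ordinals.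
    countable-cofinality⇒nonstationary : ∀ {ν τ T} → IsLimit ν → τ ≤ ℵ₀ → CofinalMap τ [ ν ] →
      Bounds τ [ ν ] → (∀ δ → δ ∈ T → DenseBelow δ) → ¬ Stationary (T ∩ ↓ [ ν ]) [ ν ]
    countable-cofinality⇒nonstationary {ν} {τ} {T} (_ , dense) τ≤ℵ₀ (c , c<ν , c-cofinal)
      bounds T-dense (_ , meets) =
      let (δ , δ∈T∩ν , δ∈D) = meets (comprehension D) D-club
          (t , t<τ , δ≡) = ∈⁻ D δ∈D
          (η , xt≺η , η≺δ) = T-dense δ (proj₁ (Equivalence.to (T-∧ {T δ}) δ∈T∩ν)) (x t)
            (subst (x t ≺_) (sym δ≡) (≺-suc (x t)))
      in suc-≼ xt≺η (subst (η ≺_) δ≡ η≺δ)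
      where
      levels : ∃ λ (x : K → K) → (∀ t → [ t ] < τ → [ x t ] < [ ν ]) ×
        (∀ s t → s ≺ t → [ t ] < τ → x s ≺ x t) × (∀ t → [ t ] < τ → c t ≼ x t)
      levels = chain bounds id c (λ _ p → p) c<ν
      x : K → K
      x = proj₁ levels
      x≺ν : ∀ t → [ t ] < τ → x t ≺ ν
      x≺ν t t<τ = [<]-injective (proj₁ (proj₂ levels) t t<τ)
      x-cofinal : ∀ ξ → ξ ≺ ν → ∃ λ t → [ t ] < τ × ξ ≼ x t
      x-cofinal ξ ξ≺ν = let (t , t<τ , ξ≤ct) = c-cofinal ξ (↑ ξ≺ν) in
        t , t<τ , ≼-trans (≤⇒≼ ξ≤ct) (proj₂ (proj₂ (proj₂ levels)) t t<τ)
      x-reflects : ∀ {s t} → [ s ] < τ → x s ≺ x t → s ≺ t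
      x-reflects {s} {t} s<τ xs≺xt with ≺.compare s t
      ... | tri< s≺t _ _ = s≺t
      ... | tri≈ _ refl _ = ⊥-elim (≺-irrefl xs≺xt)
      ... | tri> _ _ t≺s = ⊥-elim (≺⇒≼ xs≺xt (proj₁ (proj₂ (proj₂ levels)) t s t≺s s<τ))
      D : K → Set ℓ
      D δ = ∃ λ t → [ t ] < τ × δ ≡ suc⁺ (x t)
      D≺ν : ∀ t → [ t ] < τ → suc⁺ (x t) ≺ ν
      D≺ν t t<τ = let (η , xt≺η , η≺ν) = dense (x t) (x≺ν t t<τ) in ≼-≺-trans (suc-≼ xt≺η) η≺ν
      -- With `t` first such that `δ ≼ x t`, points of `D` approach `δ` through indices before `t`;
      -- so `[ t ]` is infinite, although `[ t ] < τ ≤ ℵ₀`.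
      no-limit : ∀ δ → δ ≺ ν → ¬ LimitPoint (comprehension D) δ
      no-limit δ δ≺ν ((ξ₀ , ξ₀≺δ) , limit) =
        ≤⇒≯ (proj₂ (least-spec Infinite ([ t ] , infinite)) [ t ] infinite) (<-≤-trans t<τ τ≤ℵ₀)
        where
        first : ∃ λ t → ([ t ] < τ × δ ≼ x t) × (∀ s → [ s ] < τ × δ ≼ x s → t ≼ s)
        first = minimum (λ t → [ t ] < τ × δ ≼ x t) (x-cofinal δ δ≺ν)
        t : K
        t = proj₁ first
        t<τ : [ t ] < τ
        t<τ = proj₁ (proj₁ (proj₂ first))
        δ≼xt : δ ≼ x t
        δ≼xt = proj₂ (proj₁ (proj₂ first))
        below-t : ∀ s → s ≺ t → x s ≺ δ
        below-t s s≺t = dne em λ δ≼xs →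
          proj₂ (proj₂ first) s (<.trans (↑ s≺t) t<τ , δ≼xs) s≺t
        term-between : ∀ ξ → ξ ≺ δ → ∃ λ s → s ≺ t × ξ ≺ suc⁺ (x s) × suc⁺ (x s) ≺ δ
        term-between ξ ξ≺δ =
          let (η , η∈D , ξ≺η , η≺δ) = limit ξ ξ≺δ
              (s , s<τ , η≡) = ∈⁻ D η∈D
              sxs≺δ = subst (_≺ δ) η≡ η≺δ
          in s , x-reflects s<τ (≺-≼-trans (≺.trans (≺-suc (x s)) sxs≺δ) δ≼xt) ,
             subst (ξ ≺_) η≡ ξ≺η , sxs≺δ
        infinite : Infinite [ t ]
        infinite = limit-Infinite t
          (let (s , s≺t , _) = term-between ξ₀ ξ₀≺δ in s , s≺t) next
          where
          next : ∀ s → s ≺ t → ∃ λ s′ → s′ ≺ t × s ≺ s′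
          next s s≺t =
            -- `s₁` may be `s` itself; the second application gives a strictly later index.
            let (s₁ , s₁≺t , xs≺sxs₁ , sxs₁≺δ) = term-between (x s) (below-t s s≺t)
                (s₂ , s₂≺t , sxs₁≺sxs₂ , _) = term-between (suc⁺ (x s₁)) sxs₁≺δ
                xs≼xs₁ : x s ≼ x s₁
                xs≼xs₁ = λ xs₁≺xs → suc-≼ xs₁≺xs xs≺sxs₁
                xs₁≺xs₂ : x s₁ ≺ x s₂
                xs₁≺xs₂ = dne em λ xs₂≼xs₁ → suc-≼ (≼-≺-trans xs₂≼xs₁ (≺-suc (x s₁))) sxs₁≺sxs₂
            in s₂ , s₂≺t , x-reflects (<.trans (↑ s≺t) t<τ) (≼-≺-trans xs≼xs₁ xs₁≺xs₂)
      D-club : Club (comprehension D) [ ν ]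
      D-club = (λ δ δ∈D → let (t , t<τ , δ≡) = ∈⁻ D δ∈D in
                  ↓⁺ {[ ν ]} (↑ (subst (_≺ ν) (sym δ≡) (D≺ν t t<τ)))) ,
               (λ ξ ξ<ν → let (t , t<τ , ξ≼xt) = x-cofinal ξ ([<]-injective ξ<ν) in
                  suc⁺ (x t) , ∈⁺ D (t , t<τ , refl) , inj₁ (↑ (≼-≺-trans ξ≼xt (≺-suc (x t)))) ,
                  ↑ (D≺ν t t<τ)) ,
               λ δ δ<ν limit → ⊥-elim (no-limit δ ([<]-injective δ<ν) limit)

    stationary⇒uncountable-cf : ∀ {ν T} → IsLimit ν → (∀ δ → δ ∈ T → DenseBelow δ) →
      Stationary (T ∩ ↓ [ ν ]) [ ν ] → ℵ₀ < cf [ ν ]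
    stationary⇒uncountable-cf {ν} {T} limit dense stationary = <-dne λ ¬lt →
      countable-cofinality⇒nonstationary {ν} {cf [ ν ]} {T} limit (≮⇒≥ ¬lt)
        (cf-cofinal [ ν ]) (cf-bounds [ ν ]) dense stationary
      where
      <-dne : ∀ {μ ν} → ¬ ¬ μ < ν → μ < ν
      <-dne = dne em

    -- Completeness and simultaneous reflection.

    cardinality : ∀ σ → ∃ λ μ → μ ≤ σ × IsCardinal μ × (Elt (↓ σ) ↣ Elt (↓ μ))
    cardinality σ = of-least (least-spec Embeds (σ , Identity.↣-id _))
      where
      Embeds : Ord → Set ℓ
      Embeds μ = Elt (↓ σ) ↣ Elt (↓ μ)
      of-least : ∀ {μ} → Embeds μ × (∀ ν → Embeds ν → μ ≤ ν) → ∃ λ μ → μ ≤ σ × IsCardinal μ × Embeds μ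
      of-least {μ} (e , μ-least) = μ , μ-least σ (Identity.↣-id _) , initial , e
        where
        initial : IsCardinal μ
        initial α α<μ = inclusion , λ e′ →
          ≤⇒≯ (μ-least [ α ] (e′ Compose.↣-∘ e)) α<μ
          where
          inclusion : Elt (↓ [ α ]) ↣ Elt (↓ μ)
          inclusion = mk↣ {to = λ (x , x∈α) → x , ↓⁺ {μ} (<.trans (↓⁻ {[ α ]} x∈α) α<μ)}
            λ {u} {v} eq → Elt-≡ {A = ↓ [ α ]} {u} {v} (cong proj₁ eq)

    -- `comp` ranges over cardinals, while `σ` is any ordinal; the family is reindexed along an
    -- injection into the cardinality `μ` of `σ`, with empty sets outside its range.
    null-union : ∀ {σ} → σ < comp I → (N : K → K → Set ℓ) → (∀ i → [ i ] < σ → Null (N i)) →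
      Null (λ α → ∃ λ i → [ i ] < σ × N i α)
    null-union {σ} σ<comp N null =
      let (μ , μ≤σ , cardinal , e) = cardinality σ in transfer e (closed μ≤σ cardinal)
      where
      closed : ∀ {μ} → μ ≤ σ → IsCardinal μ → ClosedUnderUnions I μ
      closed {μ} μ≤σ cardinal = dne em λ ¬closed →
        ≤⇒≯ (proj₂ (least-spec (λ τ → IsCardinal τ × ¬ ClosedUnderUnions I τ) (μ , cardinal , ¬closed))
          μ (cardinal , ¬closed)) (≤-<-trans μ≤σ σ<comp)
      transfer : ∀ {μ} → Elt (↓ σ) ↣ Elt (↓ μ) → ClosedUnderUnions I μ →
        Null (λ α → ∃ λ i → [ i ] < σ × N i α)
      transfer {μ} e closed = downward
        (λ α m → let (i , i<σ , n) = ∈⁻ (λ α → ∃ λ i → [ i ] < σ × N i α) m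
                     u = i , ↓⁺ {σ} i<σ
                 in ∈⁺ (λ α → ∃ λ j → j ∈ ↓ μ × α ∈ A j)
                      (proj₁ (to u) , proj₂ (to u) , ∈⁺ (Copy (proj₁ (to u))) (u , refl , n)))
        (closed A A-null)
        where
        open Injection e using (to; injective)
        Copy : K → K → Set ℓ
        Copy j α = ∃ λ (u : Elt (↓ σ)) → proj₁ (to u) ≡ j × N (proj₁ u) α
        A : K → Subset
        A j = comprehension (Copy j)
        A-null : ∀ j → [ j ] < μ → I (A j)
        A-null j j<μ with em {∃ λ (u : Elt (↓ σ)) → proj₁ (to u) ≡ j}
        ... | no ¬u = bounded (θ , λ α m → let (u , eq , _) = ∈⁻ (Copy j) m in ⊥-elim (¬u (u , eq)))
        ... | yes (u , u↦j) = null-mono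
          (λ α (v , v↦j , n) → subst (λ i → N i α)
            (cong proj₁ (injective {v} {u} (Elt-≡ {A = ↓ μ} (trans v↦j (sym u↦j))))) n)
          (null (proj₁ u) (↓⁻ {σ} (proj₂ u)))

    -- The exceptional sets of all `A i` have a null union, so one `α` serves every `i`, and `f α`
    -- is the reflection point. Its cofinality is uncountable because it is a limit and no member of
    -- `S* I` is a successor.
    reflection : ∀ f → Big f → Least f → Refl< (comp I) (S* I)
    reflection f f-big f-least σ σ<comp A A-spec =
      let (α , reflects , limit) = almost⇒∃ (almost-×
            (almost-map {P = λ α → ¬ (∃ λ i → [ i ] < σ × ¬ Stationary (A i ∩ ↓ [ f α ]) [ f α ])}
              (λ α ¬e i i<σ → dne em λ ¬s → ¬e (i , i<σ , ¬s))
              (Null⇒Almost¬ (null-union σ<comp (λ i α → ¬ Stationary (A i ∩ ↓ [ f α ]) [ f α ])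
                λ i i<σ → almost-reflects f f-big f-least (A i) (proj₁ (A-spec i i<σ)) (proj₂ (A-spec i i<σ)))))
            (least⇒almost-limit f f-big f-least)) θ
      in f α , λ i i<σ → stationary⇒uncountable-cf {f α} {A i} limit
           (λ δ δ∈A → S*⇒dense δ (proj₂ (A-spec i i<σ) δ δ∈A)) (reflects i i<σ) , reflects i i<σ

theorem3p3 : ∀ {ℓ : Level} (em : ExcludedMiddle ℓ) → Extensionality ℓ ℓ →
  (W : WellOrder ℓ) →
  let open WellOrder W using () renaming (Carrier to K)
      open Combinatorics em W
  in
  Regular κ →
  (I : Subset → Set ℓ) → IsIdeal I →
  (θ : K) → Regular [ θ ] →
  WeaklySaturated I [ θ ] → Indecomposable I [ θ ] →
  Stationary (S* I) κ ×
  (∃ λ (f* : K → K) → IsLeastFunction I f* ×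
    (∀ S → Stationary S κ → S ⊆ S* I →
      AlmostAll I (λ α → Stationary (S ∩ ↓ [ f* α ]) [ f* α ]))) ×
  (Stationary (S* I) κ × Refl< (comp I) (S* I))
theorem3p3 em ext W κ-regular I isIdeal θ θ-regular saturated indecomposable =
  stationary-S* ,
  (f* , (unbounded , f*-least) , almost-reflects f* f*-big f*-least) ,
  stationary-S* , reflection f* f*-big f*-least
  where
  open Combinatorics em W
  open Ideals em ext W I isIdeal
  open Saturated em ext W κ-regular I isIdeal θ θ-regular saturated indecomposable
  f* : WellOrder.Carrier W → WellOrder.Carrier W
  f* = proj₁ least-function
  f*-big : Big f*
  f*-big = proj₁ (proj₂ least-function)
  f*-least : Least f*
  f*-least = proj₂ (proj₂ least-function)
  unbounded : ¬ BoundedMod I f*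
  unbounded (ξ , null) =
    let (_ , ¬above , above) = almost⇒∃ (almost-× (Null⇒Almost¬ null) (f*-big ξ)) θ in ¬above above
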